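{- Let $G$ be a connected threshold graph of order $n\ge 4$ and size $m$ with $n-1<m<\binom{n}{2}$, let $c$ be its number of type 1 vertices, $(b_1,\ldots,b_z)$ its backwards zero position sequence, $F_1=\sum_{i=1}^z b_i^2$, and $\rho$ the spectral radius of its adjacency matrix. Then the greatest real root $\xi$ of the polynomial $x^3-(c+1)x^2+cx-F_1$ satisfies $\xi\le 1+\rho$.
   Context: A threshold graph is a simple graph whose vertices can be ordered $v_1,\ldots,v_n$ so that for each $2\le i\le n$, $v_i$ is either adjacent to all of $v_1,\ldots,v_{i-1}$ (then $a_i=1$) or to none of them (then $a_i=0$); by convention $a_1=1$. Vertex $v_i$ is of type 1 if $a_i=1$ and of type 0 if $a_i=0$; $c$ and $z$ are the numbers of type 1 and type 0 vertices ($c+z=n$). The backwards zero position sequence $(b_1,\ldots,b_z)$ is defined by letting $b_i$ be the number of type 1 vertices appearing after the $i$-th type 0 vertex in the order $v_1,\ldots,v_n$. -}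

module Defs where

open import Algebra.Bundles.Raw using (RawRing)
import Algebra.Definitions.RawMonoid as RawMonoidDefs
import Algebra.Definitions.RawSemiring as RawSemiringDefs
open import Data.Bool.Base using (Bool; true; false; if_then_else_)
import Data.Bool.Properties as Bool
open import Data.Fin.Base as Fin using (Fin; toℕ)
import Data.Fin.Properties as Fin
open import Data.Fin.Permutation using (Permutation′; _⟨$⟩ʳ_)
open import Data.Integer.Base using (+_)
open import Data.List.Base using (List; map; length; filter; allFin; cartesianProduct)
open import Data.Nat.Base as ℕ using (ℕ)
open import Data.Nat.ListAction using (sum)
import Data.Nat.Properties as ℕ
open import Data.Product.Base using (_×_; _,_; ∃-syntax; Σ-syntax; proj₁; proj₂)
open import Data.Rational.Base as ℚ using (ℚ; 0ℚ; 1ℚ; ½; _/_; 1/_; ∣_∣; Positive; positive)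
import Data.Rational.Properties as ℚ
open import Data.Rational.Solver using (module +-*-Solver)
open import Level using (0ℓ)
open import Relation.Binary.Construct.Closure.ReflexiveTransitive using (Star)
open import Relation.Binary.Core using (Rel)
open import Relation.Binary.Definitions using (Decidable; Irreflexive; Symmetric)
open import Relation.Binary.PropositionalEquality
  using (_≡_; refl; sym; trans; cong; subst; module ≡-Reasoning)
open import Relation.Nullary using (¬_; does)
open import Relation.Nullary.Decidable using (_×-dec_)

------------------------------------------------------------------------
-- A real number is a Cauchy sequence of rationals; equality of reals is _≃_
-- below, not _≡_.

IsCauchy : (ℕ → ℚ) → Set
IsCauchy s = ∀ ε → 0ℚ ℚ.< ε →
  ∃[ N ] (∀ m n → N ℕ.≤ m → N ℕ.≤ n → ∣ s m ℚ.- s n ∣ ℚ.< ε)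

record ℝ : Set where
  constructor mkℝ
  field
    seq    : ℕ → ℚ
    cauchy : IsCauchy seq

open ℝ public

infix 4 _≃_ _≤_

record _≃_ (x y : ℝ) : Set where
  constructor mk≃
  field
    close : ∀ ε → 0ℚ ℚ.< ε →
      ∃[ N ] (∀ n → N ℕ.≤ n → ∣ seq x n ℚ.- seq y n ∣ ℚ.< ε)

record _≤_ (x y : ℝ) : Set where
  constructor mk≤
  field
    below : ∀ ε → 0ℚ ℚ.< ε →
      ∃[ N ] (∀ n → N ℕ.≤ n → seq x n ℚ.< seq y n ℚ.+ ε)

fromℚ : ℚ → ℝ
fromℚ q = mkℝ (λ _ → q) λ ε ε>0 →
  0 , λ _ _ _ _ → subst (ℚ._< ε) (sym (cong ∣_∣ (ℚ.+-inverseʳ q))) ε>0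

fromℕ : ℕ → ℝ
fromℕ k = fromℚ (+ k / 1)

half>0 : ∀ {ε} → 0ℚ ℚ.< ε → 0ℚ ℚ.< ½ ℚ.* ε
half>0 {ε} ε>0 =
  ℚ.positive⁻¹ _ {{ℚ.pos*pos⇒pos ½ ε {{positive ε>0}}}}

half+half : ∀ ε → ½ ℚ.* ε ℚ.+ ½ ℚ.* ε ≡ ε
half+half ε =
  trans (sym (ℚ.*-distribʳ-+ ε ½ ½)) (ℚ.*-identityˡ ε)

+-split : ∀ a b c d → (a ℚ.+ b) ℚ.- (c ℚ.+ d) ≡ (a ℚ.- c) ℚ.+ (b ℚ.- d)
+-split = solve 4 (λ a b c d →
    (a :+ b) :- (c :+ d) := (a :- c) :+ (b :- d)) refl
  where open +-*-Solver

*-split : ∀ a b c d → a ℚ.* b ℚ.- c ℚ.* d ≡ a ℚ.* (b ℚ.- d) ℚ.+ d ℚ.* (a ℚ.- c)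
*-split = solve 4 (λ a b c d →
    a :* b :- c :* d := a :* (b :- d) :+ d :* (a :- c)) refl
  where open +-*-Solver

eventuallyBounded : ∀ s → IsCauchy s →
  ∃[ B ] ∃[ N ] (0ℚ ℚ.< B × ∀ n → N ℕ.≤ n → ∣ s n ∣ ℚ.≤ B)
eventuallyBounded s c = 1ℚ ℚ.+ ∣ s N ∣ , N , B>0 , bound
  where
  N = proj₁ (c 1ℚ (ℚ.positive⁻¹ 1ℚ))
  B>0 : 0ℚ ℚ.< 1ℚ ℚ.+ ∣ s N ∣
  B>0 = ℚ.+-mono-<-≤ (ℚ.positive⁻¹ 1ℚ) (ℚ.0≤∣p∣ (s N))
  shift : ∀ a b → (a ℚ.- b) ℚ.+ b ≡ a
  shift = solve 2 (λ a b → (a :- b) :+ b := a) refl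
    where open +-*-Solver
  bound : ∀ n → N ℕ.≤ n → ∣ s n ∣ ℚ.≤ 1ℚ ℚ.+ ∣ s N ∣
  bound n N≤n = begin
    ∣ s n ∣                          ≡⟨ cong ∣_∣ (shift (s n) (s N)) ⟨
    ∣ (s n ℚ.- s N) ℚ.+ s N ∣        ≤⟨ ℚ.∣p+q∣≤∣p∣+∣q∣ (s n ℚ.- s N) (s N) ⟩
    ∣ s n ℚ.- s N ∣ ℚ.+ ∣ s N ∣      ≤⟨ ℚ.+-monoˡ-≤ ∣ s N ∣ (ℚ.<⇒≤
                                         (proj₂ (c 1ℚ (ℚ.positive⁻¹ 1ℚ)) n N N≤n ℕ.≤-refl)) ⟩
    1ℚ ℚ.+ ∣ s N ∣                   ∎
    where open ℚ.≤-Reasoning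

+-cauchy : ∀ s t → IsCauchy s → IsCauchy t → IsCauchy (λ n → s n ℚ.+ t n)
+-cauchy s t cs ct ε ε>0 = N₁ ℕ.⊔ N₂ , close
  where
  N₁ = proj₁ (cs (½ ℚ.* ε) (half>0 ε>0))
  N₂ = proj₁ (ct (½ ℚ.* ε) (half>0 ε>0))
  close : ∀ m n → N₁ ℕ.⊔ N₂ ℕ.≤ m → N₁ ℕ.⊔ N₂ ℕ.≤ n →
          ∣ (s m ℚ.+ t m) ℚ.- (s n ℚ.+ t n) ∣ ℚ.< ε
  close m n N≤m N≤n = begin-strict
    ∣ (s m ℚ.+ t m) ℚ.- (s n ℚ.+ t n) ∣    ≡⟨ cong ∣_∣ (+-split (s m) (t m) (s n) (t n)) ⟩
    ∣ (s m ℚ.- s n) ℚ.+ (t m ℚ.- t n) ∣    ≤⟨ ℚ.∣p+q∣≤∣p∣+∣q∣ (s m ℚ.- s n) (t m ℚ.- t n) ⟩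
    ∣ s m ℚ.- s n ∣ ℚ.+ ∣ t m ℚ.- t n ∣    <⟨ ℚ.+-mono-<
      (proj₂ (cs (½ ℚ.* ε) (half>0 ε>0)) m n
        (ℕ.m⊔n≤o⇒m≤o N₁ N₂ N≤m) (ℕ.m⊔n≤o⇒m≤o N₁ N₂ N≤n))
      (proj₂ (ct (½ ℚ.* ε) (half>0 ε>0)) m n
        (ℕ.m⊔n≤o⇒n≤o N₁ N₂ N≤m) (ℕ.m⊔n≤o⇒n≤o N₁ N₂ N≤n)) ⟩
    ½ ℚ.* ε ℚ.+ ½ ℚ.* ε                    ≡⟨ half+half ε ⟩
    ε                                      ∎
    where open ℚ.≤-Reasoning

neg-cauchy : ∀ s → IsCauchy s → IsCauchy (λ n → ℚ.- s n)
neg-cauchy s cs ε ε>0 = proj₁ (cs ε ε>0) , λ m n N≤m N≤n →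
  subst (ℚ._< ε) (flip (s m) (s n)) (proj₂ (cs ε ε>0) m n N≤m N≤n)
  where
  flip : ∀ a b → ∣ a ℚ.- b ∣ ≡ ∣ ℚ.- a ℚ.- ℚ.- b ∣
  flip a b = trans (sym (ℚ.∣-p∣≡∣p∣ (a ℚ.- b)))
    (cong ∣_∣ (ℚ.neg-distrib-+ a (ℚ.- b)))

splitting : ∀ A B ε → 0ℚ ℚ.< A → 0ℚ ℚ.< B → 0ℚ ℚ.< ε →
  ∃[ δ ] (0ℚ ℚ.< δ × A ℚ.* δ ℚ.+ B ℚ.* δ ≡ ε)
splitting A B ε A>0 B>0 ε>0 = divide (A ℚ.+ B) refl {{positive (ℚ.+-mono-< A>0 B>0)}}
  where
  divide : ∀ C → A ℚ.+ B ≡ C → .{{_ : Positive C}} →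
    ∃[ δ ] (0ℚ ℚ.< δ × A ℚ.* δ ℚ.+ B ℚ.* δ ≡ ε)
  divide C eq = C⁻¹ ℚ.* ε , δ>0 , (begin
    A ℚ.* (C⁻¹ ℚ.* ε) ℚ.+ B ℚ.* (C⁻¹ ℚ.* ε)  ≡⟨ ℚ.*-distribʳ-+ (C⁻¹ ℚ.* ε) A B ⟨
    (A ℚ.+ B) ℚ.* (C⁻¹ ℚ.* ε)                ≡⟨ cong (ℚ._* (C⁻¹ ℚ.* ε)) eq ⟩
    C ℚ.* (C⁻¹ ℚ.* ε)                        ≡⟨ ℚ.*-assoc C C⁻¹ ε ⟨
    (C ℚ.* C⁻¹) ℚ.* ε                        ≡⟨ cong (ℚ._* ε) (ℚ.*-inverseʳ C {{ℚ.pos⇒nonZero C}}) ⟩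
    1ℚ ℚ.* ε                                 ≡⟨ ℚ.*-identityˡ ε ⟩
    ε                                        ∎)
    where
    open ≡-Reasoning
    C⁻¹ = (1/ C) {{ℚ.pos⇒nonZero C}}
    δ>0 : 0ℚ ℚ.< C⁻¹ ℚ.* ε
    δ>0 = ℚ.positive⁻¹ (C⁻¹ ℚ.* ε)
      {{ℚ.pos*pos⇒pos C⁻¹ {{ℚ.1/pos⇒pos C}} ε {{positive ε>0}}}}

*-bound : ∀ {K δ} x d → 0ℚ ℚ.< K → ∣ x ∣ ℚ.≤ K → ∣ d ∣ ℚ.< δ →
          ∣ x ℚ.* d ∣ ℚ.< K ℚ.* δ
*-bound {K} {δ} x d K>0 ∣x∣≤K ∣d∣<δ = begin-strict
  ∣ x ℚ.* d ∣        ≡⟨ ℚ.∣p*q∣≡∣p∣*∣q∣ x d ⟩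
  ∣ x ∣ ℚ.* ∣ d ∣    ≤⟨ ℚ.*-monoʳ-≤-nonNeg ∣ d ∣ {{ℚ.∣-∣-nonNeg d}} ∣x∣≤K ⟩
  K ℚ.* ∣ d ∣        <⟨ ℚ.*-monoʳ-<-pos K {{positive K>0}} ∣d∣<δ ⟩
  K ℚ.* δ            ∎
  where open ℚ.≤-Reasoning

*-close : ∀ {A B δ} a b c d → 0ℚ ℚ.< A → 0ℚ ℚ.< B → ∣ a ∣ ℚ.≤ A → ∣ d ∣ ℚ.≤ B →
  ∣ a ℚ.- c ∣ ℚ.< δ → ∣ b ℚ.- d ∣ ℚ.< δ →
  ∣ a ℚ.* b ℚ.- c ℚ.* d ∣ ℚ.< A ℚ.* δ ℚ.+ B ℚ.* δ
*-close {A} {B} {δ} a b c d A>0 B>0 ∣a∣≤A ∣d∣≤B a-c<δ b-d<δ = begin-strict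
  ∣ a ℚ.* b ℚ.- c ℚ.* d ∣                            ≡⟨ cong ∣_∣ (*-split a b c d) ⟩
  ∣ a ℚ.* (b ℚ.- d) ℚ.+ d ℚ.* (a ℚ.- c) ∣            ≤⟨ ℚ.∣p+q∣≤∣p∣+∣q∣ (a ℚ.* (b ℚ.- d)) (d ℚ.* (a ℚ.- c)) ⟩
  ∣ a ℚ.* (b ℚ.- d) ∣ ℚ.+ ∣ d ℚ.* (a ℚ.- c) ∣        <⟨ ℚ.+-mono-<
                                                         (*-bound a (b ℚ.- d) A>0 ∣a∣≤A b-d<δ)
                                                         (*-bound d (a ℚ.- c) B>0 ∣d∣≤B a-c<δ) ⟩
  A ℚ.* δ ℚ.+ B ℚ.* δ                                ∎
  where open ℚ.≤-Reasoning

*-cauchy : ∀ s t → IsCauchy s → IsCauchy t → IsCauchy (λ n → s n ℚ.* t n)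
*-cauchy s t cs ct ε ε>0 =
  let A , M , A>0 , boundA = eventuallyBounded s cs
      B , N , B>0 , boundB = eventuallyBounded t ct
      δ , δ>0 , eq         = splitting A B ε A>0 B>0 ε>0
      P , closeS           = cs δ δ>0
      Q , closeT           = ct δ δ>0
      left  = λ k (p : (M ℕ.⊔ N) ℕ.⊔ (P ℕ.⊔ Q) ℕ.≤ k) → ℕ.m⊔n≤o⇒m≤o (M ℕ.⊔ N) (P ℕ.⊔ Q) p
      right = λ k (p : (M ℕ.⊔ N) ℕ.⊔ (P ℕ.⊔ Q) ℕ.≤ k) → ℕ.m⊔n≤o⇒n≤o (M ℕ.⊔ N) (P ℕ.⊔ Q) p
  in (M ℕ.⊔ N) ℕ.⊔ (P ℕ.⊔ Q) , λ m n m≥ n≥ →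
    subst (∣ s m ℚ.* t m ℚ.- s n ℚ.* t n ∣ ℚ.<_) eq
      (*-close (s m) (t m) (s n) (t n) A>0 B>0
        (boundA m (ℕ.m⊔n≤o⇒m≤o M N (left m m≥)))
        (boundB n (ℕ.m⊔n≤o⇒n≤o M N (left n n≥)))
        (closeS m n (ℕ.m⊔n≤o⇒m≤o P Q (right m m≥)) (ℕ.m⊔n≤o⇒m≤o P Q (right n n≥)))
        (closeT m n (ℕ.m⊔n≤o⇒n≤o P Q (right m m≥)) (ℕ.m⊔n≤o⇒n≤o P Q (right n n≥))))

infixl 6 _+_ _-_
infixl 7 _*_
infix  8 -_

_+_ : ℝ → ℝ → ℝ
x + y = mkℝ (λ n → seq x n ℚ.+ seq y n) (+-cauchy (seq x) (seq y) (cauchy x) (cauchy y))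

-_ : ℝ → ℝ
- x = mkℝ (λ n → ℚ.- seq x n) (neg-cauchy (seq x) (cauchy x))

_*_ : ℝ → ℝ → ℝ
x * y = mkℝ (λ n → seq x n ℚ.* seq y n) (*-cauchy (seq x) (seq y) (cauchy x) (cauchy y))

_-_ : ℝ → ℝ → ℝ
x - y = x + - y

0ℝ 1ℝ : ℝ
0ℝ = fromℚ 0ℚ
1ℝ = fromℚ 1ℚ

ℝ-rawRing : RawRing 0ℓ 0ℓ
ℝ-rawRing = record
  { Carrier = ℝ ; _≈_ = _≃_ ; _+_ = _+_ ; _*_ = _*_ ; -_ = -_ ; 0# = 0ℝ ; 1# = 1ℝ }

open RawSemiringDefs (RawRing.rawSemiring ℝ-rawRing) public using (_^_)

IsGreatestRoot : (ℝ → ℝ) → ℝ → Set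
IsGreatestRoot p ξ = p ξ ≃ 0ℝ × (∀ x → p x ≃ 0ℝ → x ≤ ξ)

------------------------------------------------------------------------

record ℂ : Set where
  constructor _+i_
  field
    re im : ℝ

open ℂ public

infix 4 _≃ℂ_

record _≃ℂ_ (w z : ℂ) : Set where
  constructor mk≃ℂ
  field
    re≃ : re w ≃ re z
    im≃ : im w ≃ im z

ℂ-rawRing : RawRing 0ℓ 0ℓ
ℂ-rawRing = record
  { Carrier = ℂ
  ; _≈_     = _≃ℂ_
  ; _+_     = λ w z → (re w + re z) +i (im w + im z)
  ; _*_     = λ w z → (re w * re z - im w * im z) +i (re w * im z + im w * re z)
  ; -_      = λ z → (- re z) +i (- im z)
  ; 0#      = 0ℝ +i 0ℝ
  ; 1#      = 1ℝ +i 0ℝ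
  }

ofReal : ℝ → ℂ
ofReal x = x +i 0ℝ

-- r = |z|
IsModulus : ℝ → ℂ → Set
IsModulus r z = 0ℝ ≤ r × r ^ 2 ≃ re z ^ 2 + im z ^ 2

------------------------------------------------------------------------

Matrix : Set → ℕ → Set
Matrix A n = Fin n → Fin n → A

module _ {n : ℕ} where
  open RawRing ℂ-rawRing using (0#; +-rawMonoid) renaming (_*_ to _∙_)
  open RawMonoidDefs +-rawMonoid using () renaming (sum to ∑)

  IsEigenvalue : Matrix ℂ n → ℂ → Set
  IsEigenvalue M μ = Σ[ v ∈ (Fin n → ℂ) ]
    (¬ (∀ i → v i ≃ℂ 0#) × (∀ i → ∑ (λ j → M i j ∙ v j) ≃ℂ μ ∙ v i))

-- ρ is the maximum of |μ| over all complex eigenvalues μ of M.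
IsSpectralRadius : ∀ {n} → Matrix ℝ n → ℝ → Set
IsSpectralRadius M ρ =
    (∃[ μ ] (IsEigenvalue Mℂ μ × IsModulus ρ μ))
  × (∀ μ r → IsEigenvalue Mℂ μ → IsModulus r μ → r ≤ ρ)
  where Mℂ = λ i j → ofReal (M i j)

------------------------------------------------------------------------

record SimpleGraph (n : ℕ) : Set₁ where
  field
    Adj    : Rel (Fin n) 0ℓ
    adj?   : Decidable Adj
    symm   : Symmetric Adj
    irrefl : Irreflexive _≡_ Adj

module _ {n : ℕ} (G : SimpleGraph n) where
  open SimpleGraph G

  Connected : Set
  Connected = ∀ u v → Star Adj u v

  -- Each edge {u, v} is counted once, as the pair with u < v.
  size : ℕ
  size = length (filter (λ (u , v) → (u Fin.<? v) ×-dec adj? u v)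
                        (cartesianProduct (allFin n) (allFin n)))

  adjacencyMatrix : Matrix ℝ n
  adjacencyMatrix u v = if does (adj? u v) then 1ℝ else 0ℝ

  -- The vertex order v₁, …, vₙ witnessing that G is a threshold graph, with
  -- its types: vertex i is vᵢ₊₁ (positions start at 0), and type1 i ≡ true
  -- encodes aᵢ₊₁ = 1.
  record ThresholdOrder : Set where
    field
      order    : Permutation′ n
      type1    : Fin n → Bool

    vertex : Fin n → Fin n
    vertex i = order ⟨$⟩ʳ i

    field
      first    : ∀ i → toℕ i ≡ 0 → type1 i ≡ true
      joined   : ∀ i j → j Fin.< i → type1 i ≡ true  → Adj (vertex i) (vertex j)
      isolated : ∀ i j → j Fin.< i → type1 i ≡ false → ¬ Adj (vertex i) (vertex j)

    c : ℕ
    c = length (filter (λ i → type1 i Bool.≟ true) (allFin n))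

    type1After : Fin n → ℕ
    type1After i =
      length (filter (λ j → (i Fin.<? j) ×-dec (type1 j Bool.≟ true)) (allFin n))

    -- The backwards zero position sequence (b₁, …, b_z); allFin is increasing,
    -- so its entries come in the order of the type 0 vertices.
    b : List ℕ
    b = map type1After (filter (λ i → type1 i Bool.≟ false) (allFin n))

    F₁ : ℕ
    F₁ = sum (map (ℕ._^ 2) b)

{-# OPTIONS --safe #-}

-- For a ≥ 1 solve the eigenvalue equations of the threshold graph from the last
-- vertex backwards, normalised so that the entries not yet determined sum to S,
-- with S = 1 at the end.  With U the sum of the type 1 entries found so far, a
-- type 1 entry is (S + U) / (a + 1) and a type 0 entry is U / a; the vector is an
-- eigenvector for a exactly when S reaches 0 at the front.
--
-- If all the S stay positive at q ≥ c - 1, then type 1 entries increase towards the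
-- end, so the b type 1 entries after a type 0 vertex weigh at least b/c of the total
-- V, and c² S ≤ (V / q) (c q (q + 1 - c) - F₁) at the front.  Hence positivity fails
-- at every q with c q (q + 1 - c) ≤ F₁.  It holds for large a and is decidable at
-- rationals, so bisection gives an eigenvalue ≥ q: at the boundary S tends to 0 at
-- the front because it is smallest there.  Thus q ≤ ρ.
--
-- If q + 1 ≥ c lies below the root ξ then (q + 1) q (q + 1 - c) ≤ F₁, and c ≤ q + 1
-- gives the condition on q.
module Submission where

open import Algebra.Bundles.Raw using (RawRing)
import Algebra.Definitions.RawMonoid as RawMonoid
import Algebra.Properties.CommutativeMonoid.Sum as Sum
open import Data.Bool.Base using (Bool; true; false; if_then_else_; not; _∧_)
import Data.Bool.Properties as Bool
open import Data.Empty using (⊥-elim)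
open import Data.Fin.Base as Fin using (Fin; zero; suc)
open import Data.Fin.Permutation using (_⟨$⟩ˡ_; inverseʳ; inverseˡ)
import Data.Fin.Properties as Fin
import Data.Integer.Base as ℤ
import Data.Integer.Properties as ℤ
open import Data.List.Base using (length; filter; tabulate; map)
open import Data.Nat.Base as ℕ using (ℕ; zero; suc)
open import Data.Nat.ListAction using () renaming (sum to sumℕ)
import Data.Nat.Properties as ℕ
open import Data.Product.Base using (_×_; _,_; ∃-syntax; proj₁; proj₂)
open import Data.Rational.Base as ℚ
  using (ℚ; 0ℚ; 1ℚ; ½; _/_; 1/_; ∣_∣; Positive; positive; nonNegative; toℚᵘ)
import Data.Rational.Properties as ℚ
open import Data.Rational.Solver using (module +-*-Solver)
open import Data.Rational.Unnormalised.Base as ℚᵘ using (mkℚᵘ; *≡*)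
import Data.Rational.Unnormalised.Properties as ℚᵘ
open import Data.Sum.Base using (_⊎_; inj₁; inj₂)
open import Data.Unit.Base using (⊤; tt)
open import Data.Vec.Base as Vec using (Vec; []; _∷_; lookup)
import Data.Vec.Properties as Vec
import Defs
open import Defs using (IsCauchy; ℝ; mkℝ; seq; cauchy; half>0; half+half; ℂ; re; im; ℂ-rawRing;
  ofReal; mk≃ℂ; mk≃; mk≤; IsModulus; IsSpectralRadius; SimpleGraph; Connected;
  adjacencyMatrix; ThresholdOrder)
open import Function.Base using (_∘_)
open import Level using (0ℓ)
open import Relation.Binary.Construct.Closure.ReflexiveTransitive
  using (Star; _◅_) renaming (ε to done)
open import Relation.Binary.Definitions using (tri<; tri≈; tri>)
open import Relation.Binary.PropositionalEquality
  using (_≡_; refl; sym; trans; cong; cong₂; subst; module ≡-Reasoning)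
open import Relation.Nullary using (¬_; Dec; yes; no; does)
open import Relation.Nullary.Decidable using (_×-dec_; dec-true; dec-false)
open import Relation.Unary using (Pred; Decidable)

open +-*-Solver using (solve; _:+_; _:*_; _:-_; :-_; con; _:=_)

module _ where
  open import Data.Rational.Base using (_+_; _-_; _*_; -_; _≤_; _<_; _⊔_)
  open Sum ℚ.+-0-commutativeMonoid using (sum; sum-cong-≗; sum-permute)
  open RawMonoid (RawRing.+-rawMonoid ℂ-rawRing) using () renaming (sum to ∑)

  -- Ordered field lemmas

  0<1 : 0ℚ < 1ℚ
  0<1 = ℚ.positive⁻¹ 1ℚ

  0≤+ : ∀ {p q} → 0ℚ ≤ p → 0ℚ ≤ q → 0ℚ ≤ p + q
  0≤+ = ℚ.+-mono-≤

  0≤* : ∀ {p q} → 0ℚ ≤ p → 0ℚ ≤ q → 0ℚ ≤ p * q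
  0≤* {p} {q} 0≤p 0≤q = ℚ.nonNegative⁻¹ (p * q)
    {{ℚ.nonNeg*nonNeg⇒nonNeg p {{nonNegative 0≤p}} q {{nonNegative 0≤q}}}}

  0<* : ∀ {p q} → 0ℚ < p → 0ℚ < q → 0ℚ < p * q
  0<* {p} {q} 0<p 0<q = ℚ.positive⁻¹ (p * q)
    {{ℚ.pos*pos⇒pos p {{positive 0<p}} q {{positive 0<q}}}}

  gap : ∀ {p q} → p ≤ q → 0ℚ ≤ q - p
  gap {p} {q} p≤q = subst (_≤ q - p) (ℚ.+-inverseʳ p) (ℚ.+-monoˡ-≤ (- p) p≤q)

  ≤-by : ∀ {p q} d → q - p ≡ d → 0ℚ ≤ d → p ≤ q
  ≤-by {p} {q} d eq 0≤d = begin
    p            ≡⟨ ℚ.+-identityʳ p ⟨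
    p + 0ℚ       ≤⟨ ℚ.+-monoʳ-≤ p (subst (0ℚ ≤_) (sym eq) 0≤d) ⟩
    p + (q - p)  ≡⟨ solve 2 (λ p q → p :+ (q :- p) := q) refl p q ⟩
    q            ∎
    where open ℚ.≤-Reasoning

  <-gap : ∀ {p q} → p < q → 0ℚ < q - p
  <-gap {p} {q} p<q = subst (_< q - p) (ℚ.+-inverseʳ p) (ℚ.+-monoˡ-< (- p) p<q)

  <-by : ∀ {p q} d → q - p ≡ d → 0ℚ < d → p < q
  <-by {p} {q} d eq 0<d = begin-strict
    p            ≡⟨ ℚ.+-identityʳ p ⟨
    p + 0ℚ       <⟨ ℚ.+-monoʳ-< p (subst (0ℚ <_) (sym eq) 0<d) ⟩
    p + (q - p)  ≡⟨ solve 2 (λ p q → p :+ (q :- p) := q) refl p q ⟩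
    q            ∎
    where open ℚ.≤-Reasoning

  private
    ⊔1-positive : ∀ a → Positive (a ⊔ 1ℚ)
    ⊔1-positive a = positive (ℚ.<-≤-trans 0<1 (ℚ.p≤q⊔p a 1ℚ))

  -- A total function, equal to 1/a only for a ≥ 1; opaque so that rationals do not unfold.
  opaque
    inv : ℚ → ℚ
    inv a = (1/ (a ⊔ 1ℚ)) {{ℚ.pos⇒nonZero (a ⊔ 1ℚ) {{⊔1-positive a}}}}

    inv>0 : ∀ a → 0ℚ < inv a
    inv>0 a = ℚ.positive⁻¹ _ {{ℚ.1/pos⇒pos (a ⊔ 1ℚ) {{⊔1-positive a}}}}

    *-inv : ∀ {a} → 1ℚ ≤ a → a * inv a ≡ 1ℚ
    *-inv {a} 1≤a = trans (cong (_* inv a) (sym (ℚ.p≥q⇒p⊔q≡p 1≤a)))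
      (ℚ.*-inverseʳ (a ⊔ 1ℚ) {{ℚ.pos⇒nonZero (a ⊔ 1ℚ) {{⊔1-positive a}}}})

  inv≥0 : ∀ a → 0ℚ ≤ inv a
  inv≥0 a = ℚ.<⇒≤ (inv>0 a)

  inv≤1 : ∀ {a} → 1ℚ ≤ a → inv a ≤ 1ℚ
  inv≤1 {a} 1≤a = ≤-by ((a - 1ℚ) * inv a)
    (trans (cong (_- inv a) (sym (*-inv 1≤a)))
      (solve 2 (λ a r → a :* r :- r := (a :- con 1ℚ) :* r) refl a (inv a)))
    (0≤* (gap 1≤a) (inv≥0 a))

  weaken-1≤ : ∀ {a} → 1ℚ ≤ a → 1ℚ ≤ a + 1ℚ
  weaken-1≤ {a} 1≤a = ℚ.≤-trans 1≤a
    (subst (_≤ a + 1ℚ) (ℚ.+-identityʳ a) (ℚ.+-monoʳ-≤ a (ℚ.<⇒≤ 0<1)))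

  -- The backward recursion

  [_] : Bool → ℚ
  [ b ] = if b then 1ℚ else 0ℚ

  entry : Bool → ℚ → ℚ → ℚ → ℚ
  entry true  s u a = (s + u) * inv (a + 1ℚ)
  entry false s u a = u * inv a

  -- S and U of the introduction, for a suffix of the type sequence.
  rest weight : ∀ {n} → Vec Bool n → ℚ → ℚ
  rest []      a = 1ℚ
  rest (b ∷ t) a = rest t a - entry b (rest t a) (weight t a) a
  weight []      a = 0ℚ
  weight (b ∷ t) a = weight t a + [ b ] * entry b (rest t a) (weight t a) a

  eigvec : ∀ {n} → Vec Bool n → ℚ → Fin n → ℚ
  eigvec (b ∷ t) a zero    = entry b (rest t a) (weight t a) a
  eigvec (b ∷ t) a (suc i) = eigvec t a i

  -- Of two distinct positions the later one decides, through its type.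
  adjacent : ∀ {n} → Vec Bool n → Fin n → Fin n → Bool
  adjacent (_ ∷ t) zero    zero    = false
  adjacent (_ ∷ t) zero    (suc j) = lookup t j
  adjacent (_ ∷ t) (suc i) zero    = lookup t i
  adjacent (_ ∷ t) (suc i) (suc j) = adjacent t i j

  -- Each entry is subtracted from `rest`, which starts at 1. Hence the entries sum to 1 where
  -- `rest` vanishes, which will make the vector nonzero.
  sum-eigvec : ∀ {n} (t : Vec Bool n) a → sum (eigvec t a) ≡ 1ℚ - rest t a
  sum-eigvec []      a = refl
  sum-eigvec (b ∷ t) a = trans (cong (eigvec (b ∷ t) a zero +_) (sum-eigvec t a))
    (solve 2 (λ v s → v :+ (con 1ℚ :- s) := con 1ℚ :- (s :- v)) refl
      (eigvec (b ∷ t) a zero) (rest t a))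

  sum-type1 : ∀ {n} (t : Vec Bool n) a → sum (λ j → [ lookup t j ] * eigvec t a j) ≡ weight t a
  sum-type1 []      a = refl
  sum-type1 (b ∷ t) a = trans (cong ([ b ] * eigvec (b ∷ t) a zero +_) (sum-type1 t a))
    (ℚ.+-comm ([ b ] * eigvec (b ∷ t) a zero) (weight t a))

  -- The eigenvalue equation of the front vertex: its neighbours are the later type 1 vertices and,
  -- for type 1, also all earlier vertices, whose still missing entries sum to `rest (b ∷ t) a`.
  entry-eq : ∀ b {n} (t : Vec Bool n) {a} → 1ℚ ≤ a →
    weight t a ≡ a * entry b (rest t a) (weight t a) a - [ b ] * rest (b ∷ t) a
  entry-eq true t {a} 1≤a = sym (trans
    (solve 4 (λ s u a r → a :* ((s :+ u) :* r) :- con 1ℚ :* (s :- (s :+ u) :* r) :=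
        ((s :+ u) :* ((a :+ con 1ℚ) :* r)) :- s) refl s u a (inv (a + 1ℚ)))
    (trans (cong (λ x → (s + u) * x - s) (*-inv (weaken-1≤ 1≤a)))
      (solve 2 (λ s u → (s :+ u) :* con 1ℚ :- s := u) refl s u)))
    where s = rest t a ; u = weight t a
  entry-eq false t {a} 1≤a = sym (trans
    (solve 4 (λ s u a r → a :* (u :* r) :- con 0ℚ :* s := u :* (a :* r)) refl
      (rest (false ∷ t) a) u a (inv a))
    (trans (cong (u *_) (*-inv 1≤a)) (ℚ.*-identityʳ u)))
    where u = weight t a

  -- The defect in a row is what the vertices before `t` must still supply. A new front vertex adds
  -- its entry to every type 1 row and takes the same amount off `rest`.
  eigen-eq : ∀ {n} (t : Vec Bool n) {a} → 1ℚ ≤ a → ∀ i →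
    sum (λ j → [ adjacent t i j ] * eigvec t a j) ≡ a * eigvec t a i - [ lookup t i ] * rest t a
  eigen-eq (b ∷ t) {a} 1≤a zero = trans
    (cong₂ _+_ (ℚ.*-zeroˡ (eigvec (b ∷ t) a zero)) (sum-type1 t a))
    (trans (ℚ.+-identityˡ (weight t a)) (entry-eq b t 1≤a))
  eigen-eq (b ∷ t) {a} 1≤a (suc i) = trans
    (cong ([ lookup t i ] * eigvec (b ∷ t) a zero +_) (eigen-eq t 1≤a i))
    (solve 4 (λ b v x s → b :* v :+ (x :- b :* s) := x :- b :* (s :- v)) refl
      [ lookup t i ] (eigvec (b ∷ t) a zero) (a * eigvec t a i) (rest t a))

  -- Positivity of the sums of undetermined entries

  AllPositive : ∀ {n} → Vec Bool n → ℚ → Set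
  AllPositive []      a = ⊤
  AllPositive (b ∷ t) a = 0ℚ < rest (b ∷ t) a × AllPositive t a

  allPositive? : ∀ {n} (t : Vec Bool n) a → Dec (AllPositive t a)
  allPositive? []      a = yes tt
  allPositive? (b ∷ t) a = (0ℚ ℚ.<? rest (b ∷ t) a) ×-dec allPositive? t a

  rest>0 : ∀ {n} (t : Vec Bool n) {a} → AllPositive t a → 0ℚ < rest t a
  rest>0 []      _       = 0<1
  rest>0 (b ∷ t) (p , _) = p

  entry≥0 : ∀ b {s u} a → 0ℚ ≤ s → 0ℚ ≤ u → 0ℚ ≤ entry b s u a
  entry≥0 true  a 0≤s 0≤u = 0≤* (0≤+ 0≤s 0≤u) (inv≥0 (a + 1ℚ))
  entry≥0 false a 0≤s 0≤u = 0≤* 0≤u (inv≥0 a)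

  [_]≥0 : ∀ b → 0ℚ ≤ [ b ]
  [ true  ]≥0 = ℚ.<⇒≤ 0<1
  [ false ]≥0 = ℚ.≤-refl

  weight≥0 : ∀ {n} (t : Vec Bool n) {a} → AllPositive t a → 0ℚ ≤ weight t a
  weight≥0 []      _           = ℚ.≤-refl
  weight≥0 (b ∷ t) {a} (_ , p) = 0≤+ (weight≥0 t p)
    (0≤* [ b ]≥0 (entry≥0 b a (ℚ.<⇒≤ (rest>0 t p)) (weight≥0 t p)))

  rest-decreasing : ∀ b {n} (t : Vec Bool n) {a} → AllPositive t a → rest (b ∷ t) a ≤ rest t a
  rest-decreasing b t {a} p = ≤-by _
    (solve 2 (λ s v → s :- (s :- v) := v) refl (rest t a) _)
    (entry≥0 b a (ℚ.<⇒≤ (rest>0 t p)) (weight≥0 t p))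

  -- ones, squares and zeroWeight stand for c, F₁ = ∑ bᵢ² and ∑ bᵢ Uᵢ, the sums being
  -- over the type 0 vertices.
  ones : ∀ {n} → Vec Bool n → ℚ
  ones []      = 0ℚ
  ones (b ∷ t) = [ b ] + ones t

  squares : ∀ {n} → Vec Bool n → ℚ
  squares []          = 0ℚ
  squares (true ∷ t)  = squares t
  squares (false ∷ t) = ones t * ones t + squares t

  zeroWeight : ∀ {n} → Vec Bool n → ℚ → ℚ
  zeroWeight []          a = 0ℚ
  zeroWeight (true ∷ t)  a = zeroWeight t a
  zeroWeight (false ∷ t) a = ones t * weight t a + zeroWeight t a

  ones≥0 : ∀ {n} (t : Vec Bool n) → 0ℚ ≤ ones t
  ones≥0 []      = ℚ.≤-refl
  ones≥0 (b ∷ t) = 0≤+ [ b ]≥0 (ones≥0 t)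

  squares≥0 : ∀ {n} (t : Vec Bool n) → 0ℚ ≤ squares t
  squares≥0 []          = ℚ.≤-refl
  squares≥0 (true ∷ t)  = squares≥0 t
  squares≥0 (false ∷ t) = 0≤+ (0≤* (ones≥0 t) (ones≥0 t)) (squares≥0 t)

  -- Sum the equations of the type 1 vertices: each type 0 entry U / a occurs once for every later
  -- type 1 vertex, which yields `zeroWeight`. The induction assembles this sum vertex by vertex.
  balance : ∀ {n} (t : Vec Bool n) {a} → 1ℚ ≤ a →
    ones t * rest t a ≡ (a + 1ℚ - ones t) * weight t a - inv a * zeroWeight t a
  balance [] {a} _ =
    solve 2 (λ a r → con 0ℚ :* con 1ℚ := (a :+ con 1ℚ :- con 0ℚ) :* con 0ℚ :- r :* con 0ℚ) refl a (inv a)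
  balance (true ∷ t) {a} 1≤a = begin
    (1ℚ + c) * (s - v)
      ≡⟨ solve 3 (λ c s v → (con 1ℚ :+ c) :* (s :- v) := c :* s :+ (s :- v :- c :* v)) refl c s v ⟩
    c * s + (s - v - c * v)
      ≡⟨ cong (_+ (s - v - c * v)) (balance t 1≤a) ⟩
    (a + 1ℚ - c) * u - r * h + (s - v - c * v)
      ≡⟨ solve 7 (λ a c u r h s v →
          (a :+ con 1ℚ :- c) :* u :- r :* h :+ (s :- v :- c :* v) :=
          (a :+ con 1ℚ :- (con 1ℚ :+ c)) :* (u :+ con 1ℚ :* v) :- r :* h :+ ((s :+ u) :- (a :+ con 1ℚ) :* v))
          refl a c u r h s v ⟩
    goal + ((s + u) - (a + 1ℚ) * v)
      ≡⟨ cong (λ x → goal + ((s + u) - x)) (trans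
          (solve 3 (λ x w y → x :* (w :* y) := w :* (x :* y)) refl (a + 1ℚ) (s + u) (inv (a + 1ℚ)))
          (trans (cong ((s + u) *_) (*-inv (weaken-1≤ 1≤a))) (ℚ.*-identityʳ (s + u)))) ⟩
    goal + ((s + u) - (s + u))
      ≡⟨ solve 2 (λ x w → x :+ (w :- w) := x) refl goal (s + u) ⟩
    goal ∎
    where
    open ≡-Reasoning
    s = rest t a ; u = weight t a ; c = ones t
    h = zeroWeight t a ; r = inv a ; v = (s + u) * inv (a + 1ℚ)
    goal = (a + 1ℚ - (1ℚ + c)) * (u + 1ℚ * v) - r * h
  balance (false ∷ t) {a} 1≤a = begin
    (0ℚ + c) * (s - u * r)
      ≡⟨ solve 4 (λ c s u r → (con 0ℚ :+ c) :* (s :- u :* r) := c :* s :- c :* (u :* r)) refl c s u r ⟩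
    c * s - c * (u * r)
      ≡⟨ cong (_- c * (u * r)) (balance t 1≤a) ⟩
    (a + 1ℚ - c) * u - r * h - c * (u * r)
      ≡⟨ solve 5 (λ a c u r h →
          (a :+ con 1ℚ :- c) :* u :- r :* h :- c :* (u :* r) :=
          (a :+ con 1ℚ :- (con 0ℚ :+ c)) :* (u :+ con 0ℚ :* (u :* r)) :- r :* (c :* u :+ h))
          refl a c u r h ⟩
    (a + 1ℚ - (0ℚ + c)) * (u + 0ℚ * (u * r)) - r * (c * u + h) ∎
    where
    open ≡-Reasoning
    s = rest t a ; u = weight t a ; c = ones t
    h = zeroWeight t a ; r = inv a

  -- The entry that a type 1 vertex put in front of t would get; it decreases as t grows.
  type1Entry : ∀ {n} → Vec Bool n → ℚ → ℚ
  type1Entry t a = entry true (rest t a) (weight t a) a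

  type1Entry-true : ∀ {n} (t : Vec Bool n) a → type1Entry (true ∷ t) a ≡ type1Entry t a
  type1Entry-true t a = cong (_* inv (a + 1ℚ))
    (solve 3 (λ s u v → s :- v :+ (u :+ con 1ℚ :* v) := s :+ u) refl (rest t a) (weight t a) _)

  type1Entry-false : ∀ {n} (t : Vec Bool n) a →
    type1Entry (false ∷ t) a ≡ type1Entry t a - weight t a * inv a * inv (a + 1ℚ)
  type1Entry-false t a = solve 4 (λ s u v r →
    (s :- v :+ (u :+ con 0ℚ :* v)) :* r := (s :+ u) :* r :- v :* r) refl
    (rest t a) (weight t a) (weight t a * inv a) (inv (a + 1ℚ))

  type0Term≥0 : ∀ {n} (t : Vec Bool n) {a} → AllPositive t a →
    0ℚ ≤ weight t a * inv a * inv (a + 1ℚ)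
  type0Term≥0 t {a} p = 0≤* (0≤* (weight≥0 t p) (inv≥0 a)) (inv≥0 (a + 1ℚ))

  -- Type 1 entries only grow towards the end, so each of the `ones t` entries collected in `weight`
  -- is at least `type1Entry t a`.
  ones*entry≤weight : ∀ {n} (t : Vec Bool n) {a} → AllPositive t a →
    ones t * type1Entry t a ≤ weight t a
  ones*entry≤weight [] {a} _ = ℚ.≤-reflexive (ℚ.*-zeroˡ (type1Entry [] a))
  ones*entry≤weight (true ∷ t) {a} (_ , p) = ≤-by _
    (trans (cong (λ x → weight (true ∷ t) a - (1ℚ + ones t) * x) (type1Entry-true t a))
      (solve 3 (λ u c w → u :+ con 1ℚ :* w :- (con 1ℚ :+ c) :* w := u :- c :* w) refl
        (weight t a) (ones t) (type1Entry t a)))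
    (gap (ones*entry≤weight t p))
  ones*entry≤weight (false ∷ t) {a} (_ , p) = ≤-by _
    (trans (cong (λ x → weight (false ∷ t) a - (0ℚ + ones t) * x) (type1Entry-false t a))
      (solve 5 (λ u c w v d → u :+ con 0ℚ :* v :- (con 0ℚ :+ c) :* (w :- d) := (u :- c :* w) :+ c :* d) refl
        (weight t a) (ones t) (type1Entry t a) (weight t a * inv a) _))
    (0≤+ (gap (ones*entry≤weight t p)) (0≤* (ones≥0 t) (type0Term≥0 t p)))

  -- Each Uᵢ is at least bᵢ times the type 1 entry at its position, hence at least bᵢ times the
  -- smaller one at the front.
  squares*entry≤zeroWeight : ∀ {n} (t : Vec Bool n) {a} → AllPositive t a →
    squares t * type1Entry t a ≤ zeroWeight t a
  squares*entry≤zeroWeight [] {a} _ = ℚ.≤-reflexive (ℚ.*-zeroˡ (type1Entry [] a))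
  squares*entry≤zeroWeight (true ∷ t) {a} (_ , p) =
    subst (λ x → squares t * x ≤ zeroWeight t a) (sym (type1Entry-true t a))
      (squares*entry≤zeroWeight t p)
  squares*entry≤zeroWeight (false ∷ t) {a} (_ , p) = ≤-by _
    (trans (cong (λ x → zeroWeight (false ∷ t) a - squares (false ∷ t) * x) (type1Entry-false t a))
      (solve 6 (λ h c u f w d → (c :* u :+ h) :- (c :* c :+ f) :* (w :- d) :=
          (h :- f :* w) :+ c :* (u :- c :* w) :+ (c :* c :+ f) :* d) refl
        (zeroWeight t a) (ones t) (weight t a) (squares t) (type1Entry t a) _))
    (0≤+ (0≤+ (gap (squares*entry≤zeroWeight t p))
              (0≤* (ones≥0 t) (gap (ones*entry≤weight t p))))
         (0≤* (squares≥0 (false ∷ t)) (type0Term≥0 t p)))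

  -- The last b of c increasing entries weigh at least b/c of their total; this is that bound
  -- multiplied by b, summed and cleared of denominators. In the induction a type 0 vertex adds the
  -- same term to both sides, and a type 1 vertex adds the two sides of `squares*entry≤zeroWeight`.
  squares*weight≤ones*zeroWeight : ∀ {n} (t : Vec Bool n) {a} → AllPositive t a →
    squares t * weight t a ≤ ones t * zeroWeight t a
  squares*weight≤ones*zeroWeight [] _ = ℚ.≤-refl
  squares*weight≤ones*zeroWeight (true ∷ t) {a} (_ , p) = ≤-by _
    (solve 5 (λ h c u f w → (con 1ℚ :+ c) :* h :- f :* (u :+ con 1ℚ :* w) :=
        (c :* h :- f :* u) :+ (h :- f :* w)) refl
      (zeroWeight t a) (ones t) (weight t a) (squares t) (type1Entry t a))
    (0≤+ (gap (squares*weight≤ones*zeroWeight t p)) (gap (squares*entry≤zeroWeight t p)))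
  squares*weight≤ones*zeroWeight (false ∷ t) {a} (_ , p) = ≤-by _
    (solve 5 (λ h c u f v → (con 0ℚ :+ c) :* (c :* u :+ h) :- (c :* c :+ f) :* (u :+ con 0ℚ :* v) :=
        c :* h :- f :* u) refl
      (zeroWeight t a) (ones t) (weight t a) (squares t) (weight t a * inv a))
    (gap (squares*weight≤ones*zeroWeight t p))

  ¬allPositive : ∀ {n} (t : Vec Bool n) {q} → 1ℚ ≤ q → 0ℚ < ones t →
    ones t * q * (q + 1ℚ - ones t) ≤ squares t → ¬ AllPositive t q
  ¬allPositive t {q} 1≤q 0<c small p = ℚ.<-irrefl refl
    (ℚ.<-≤-trans (0<* (0<* 0<c 0<c) (rest>0 t p)) (≤-by _ eq
      (0≤+ (0≤* (inv≥0 q) (gap (squares*weight≤ones*zeroWeight t p)))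
           (0≤* (0≤* (inv≥0 q) (weight≥0 t p)) (gap small)))))
    where
    open ≡-Reasoning
    c = ones t ; s = rest t q ; u = weight t q ; f = squares t ; h = zeroWeight t q ; r = inv q
    -- Minus the positive number c²S becomes a sum of two nonnegative terms, one from the averaging
    -- inequality and one from the hypothesis on `q`.
    eq : 0ℚ - c * c * s ≡ r * (c * h - f * u) + r * u * (f - c * q * (q + 1ℚ - c))
    eq = begin
      0ℚ - c * c * s
        ≡⟨ solve 2 (λ c s → con 0ℚ :- c :* c :* s := con 0ℚ :- c :* (c :* s)) refl c s ⟩
      0ℚ - c * (c * s)
        ≡⟨ cong (λ x → 0ℚ - c * x) (balance t 1≤q) ⟩
      0ℚ - c * ((q + 1ℚ - c) * u - r * h)
        ≡⟨ solve 5 (λ q c u r h → con 0ℚ :- c :* ((q :+ con 1ℚ :- c) :* u :- r :* h) :=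
            r :* (c :* h) :- u :* c :* (q :+ con 1ℚ :- c) :* con 1ℚ) refl q c u r h ⟩
      r * (c * h) - u * c * (q + 1ℚ - c) * 1ℚ
        -- The factor 1 was kept in order to become `q * inv q`, which brings out the common factor
        -- `r * u`.
        ≡⟨ cong (λ x → r * (c * h) - u * c * (q + 1ℚ - c) * x) (sym (*-inv 1≤q)) ⟩
      r * (c * h) - u * c * (q + 1ℚ - c) * (q * r)
        ≡⟨ solve 6 (λ q c u r h f → r :* (c :* h) :- u :* c :* (q :+ con 1ℚ :- c) :* (q :* r) :=
            r :* (c :* h :- f :* u) :+ r :* u :* (f :- c :* q :* (q :+ con 1ℚ :- c))) refl q c u r h f ⟩
      r * (c * h - f * u) + r * u * (f - c * q * (q + 1ℚ - c)) ∎

  -- Positivity for large arguments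

  len : ∀ {n} → Vec Bool n → ℚ
  len []      = 0ℚ
  len (_ ∷ t) = 1ℚ + len t

  len≥0 : ∀ {n} (t : Vec Bool n) → 0ℚ ≤ len t
  len≥0 []      = ℚ.≤-refl
  len≥0 (_ ∷ t) = 0≤+ (ℚ.<⇒≤ 0<1) (len≥0 t)

  inv-sub : ∀ {a b} → 1ℚ ≤ a → 1ℚ ≤ b → inv a - inv b ≡ inv a * inv b * (b - a)
  inv-sub {a} {b} 1≤a 1≤b = begin
    r - s                        ≡⟨ solve 2 (λ r s → r :- s := r :* con 1ℚ :- con 1ℚ :* s) refl r s ⟩
    r * 1ℚ - 1ℚ * s              ≡⟨ cong₂ (λ x y → r * x - y * s) (sym (*-inv 1≤b)) (sym (*-inv 1≤a)) ⟩
    r * (b * s) - (a * r) * s    ≡⟨ solve 4 (λ a b r s → r :* (b :* s) :- (a :* r) :* s := r :* s :* (b :- a))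
                                    refl a b r s ⟩
    r * s * (b - a)              ∎
    where
    open ≡-Reasoning
    r = inv a ; s = inv b

  inv-antitone-suc : ∀ {a} → 1ℚ ≤ a → inv (a + 1ℚ) ≤ inv a
  inv-antitone-suc {a} 1≤a = ≤-by (inv a * inv (a + 1ℚ))
    (trans (inv-sub 1≤a (weaken-1≤ 1≤a))
      (solve 2 (λ x a → x :* (a :+ con 1ℚ :- a) := x) refl (inv a * inv (a + 1ℚ)) a))
    (0≤* (inv≥0 a) (inv≥0 (a + 1ℚ)))

  entry≤inv : ∀ b {s u a} → 1ℚ ≤ a → 0ℚ ≤ s → s + u ≤ 1ℚ → entry b s u a ≤ inv a
  entry≤inv true {s} {u} {a} 1≤a 0≤s s+u≤1 = ℚ.≤-trans
    (≤-by ((1ℚ - (s + u)) * inv (a + 1ℚ))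
      (solve 2 (λ r w → r :- w :* r := (con 1ℚ :- w) :* r) refl (inv (a + 1ℚ)) (s + u))
      (0≤* (gap s+u≤1) (inv≥0 (a + 1ℚ))))
    (inv-antitone-suc 1≤a)
  entry≤inv false {s} {u} {a} 1≤a 0≤s s+u≤1 = ≤-by ((1ℚ - (s + u)) * inv a + s * inv a)
    (solve 3 (λ r s u → r :- u :* r := (con 1ℚ :- (s :+ u)) :* r :+ s :* r) refl (inv a) s u)
    (0≤+ (0≤* (gap s+u≤1) (inv≥0 a)) (0≤* 0≤s (inv≥0 a)))

  1-[_]≥0 : ∀ b → 0ℚ ≤ 1ℚ - [ b ]
  1-[ true  ]≥0 = ℚ.≤-refl
  1-[ false ]≥0 = ℚ.<⇒≤ 0<1

  -- With all entries counted the sum would be exactly 1; leaving out the nonnegative type 0 entries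
  -- only lowers it.
  rest+weight≤1 : ∀ {n} (t : Vec Bool n) {a} → AllPositive t a → rest t a + weight t a ≤ 1ℚ
  rest+weight≤1 []          _       = ℚ.≤-refl
  rest+weight≤1 (b ∷ t) {a} (_ , p) = ≤-by (1ℚ - (s + u) + (1ℚ - [ b ]) * v)
    (solve 4 (λ s u v b → con 1ℚ :- (s :- v :+ (u :+ b :* v)) :=
      con 1ℚ :- (s :+ u) :+ (con 1ℚ :- b) :* v) refl s u v [ b ])
    (0≤+ (gap (rest+weight≤1 t p))
         (0≤* 1-[ b ]≥0 (entry≥0 b a (ℚ.<⇒≤ (rest>0 t p)) (weight≥0 t p))))
    where s = rest t a ; u = weight t a ; v = entry b s u a

  -- Since S + U ≤ 1, every entry is at most 1/a, so at least 1 - len/a is left at the front, which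
  -- is positive once a exceeds the length. The lower bound is carried along for the induction.
  allPositive : ∀ {n} (t : Vec Bool n) {a} → 1ℚ ≤ a → len t < a →
    AllPositive t a × 1ℚ - len t * inv a ≤ rest t a
  allPositive [] {a} _ _ = tt , ℚ.≤-reflexive
    (solve 1 (λ r → con 1ℚ :- con 0ℚ :* r := con 1ℚ) refl (inv a))
  allPositive (b ∷ t) {a} 1≤a l<a = (ℚ.<-≤-trans pos lower , p) , lower
    where
    ih = allPositive t 1≤a (ℚ.≤-<-trans (≤-by 1ℚ
      (solve 1 (λ l → con 1ℚ :+ l :- l := con 1ℚ) refl (len t)) (ℚ.<⇒≤ 0<1)) l<a)
    p = proj₁ ih
    s = rest t a ; u = weight t a ; v = entry b s u a ; r = inv a
    lower : 1ℚ - (1ℚ + len t) * r ≤ s - v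
    lower = ≤-by ((s - (1ℚ - len t * r)) + (r - v))
      (solve 4 (λ s v r l → s :- v :- (con 1ℚ :- (con 1ℚ :+ l) :* r) :=
        (s :- (con 1ℚ :- l :* r)) :+ (r :- v)) refl s v r (len t))
      (0≤+ (gap (proj₂ ih)) (gap (entry≤inv b 1≤a (ℚ.<⇒≤ (rest>0 t p)) (rest+weight≤1 t p))))
    pos : 0ℚ < 1ℚ - (1ℚ + len t) * r
    pos = subst (0ℚ <_)
      (trans (solve 3 (λ a l r → (a :- l) :* r := a :* r :- l :* r) refl a (1ℚ + len t) r)
             (cong (_- (1ℚ + len t) * r) (*-inv 1≤a)))
      (0<* (<-gap l<a) (inv>0 a))

  -- Continuity of the recursion in a

  -- Everything is restricted to a ≥ 1. The bound on `f` is carried because the slope of a product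
  -- depends on it; the recursion involves `a` only through `inv`, so its values stay bounded.
  record Lipschitz (f : ℚ → ℚ) : Set where
    field
      bound slope : ℚ
      bound≥0     : 0ℚ ≤ bound
      slope≥0     : 0ℚ ≤ slope
      bounded     : ∀ a → 1ℚ ≤ a → ∣ f a ∣ ≤ bound
      lipschitz   : ∀ a b → 1ℚ ≤ a → 1ℚ ≤ b → ∣ f a - f b ∣ ≤ slope * ∣ a - b ∣

  open Lipschitz

  ∣-∣-flip : ∀ a b → ∣ a - b ∣ ≡ ∣ b - a ∣
  ∣-∣-flip a b = trans (sym (ℚ.∣-p∣≡∣p∣ (a - b)))
    (cong ∣_∣ (solve 2 (λ a b → :- (a :- b) := b :- a) refl a b))

  *-mono-≤ : ∀ {p q r s} → 0ℚ ≤ r → 0ℚ ≤ q → p ≤ q → r ≤ s → p * r ≤ q * s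
  *-mono-≤ {p} {q} {r} {s} 0≤r 0≤q p≤q r≤s = ℚ.≤-trans
    (ℚ.*-monoʳ-≤-nonNeg r {{nonNegative 0≤r}} p≤q)
    (ℚ.*-monoˡ-≤-nonNeg q {{nonNegative 0≤q}} r≤s)

  lip-const : ∀ c → Lipschitz (λ _ → c)
  lip-const c = record
    { bound = ∣ c ∣ ; slope = 0ℚ ; bound≥0 = ℚ.0≤∣p∣ c ; slope≥0 = ℚ.≤-refl
    ; bounded   = λ _ _ → ℚ.≤-refl
    ; lipschitz = λ a b _ _ → ℚ.≤-reflexive
        (trans (cong ∣_∣ (ℚ.+-inverseʳ c)) (sym (ℚ.*-zeroˡ ∣ a - b ∣)))
    }

  lip-+ : ∀ {f g} → Lipschitz f → Lipschitz g → Lipschitz (λ a → f a + g a)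
  lip-+ {f} {g} F G = record
    { bound = bound F + bound G ; slope = slope F + slope G
    ; bound≥0 = 0≤+ (bound≥0 F) (bound≥0 G) ; slope≥0 = 0≤+ (slope≥0 F) (slope≥0 G)
    ; bounded   = λ a 1≤a → ℚ.≤-trans (ℚ.∣p+q∣≤∣p∣+∣q∣ (f a) (g a))
        (ℚ.+-mono-≤ (bounded F a 1≤a) (bounded G a 1≤a))
    ; lipschitz = λ a b 1≤a 1≤b → begin
        ∣ (f a + g a) - (f b + g b) ∣
          ≡⟨ cong ∣_∣ (solve 4 (λ x y z w → (x :+ y) :- (z :+ w) := (x :- z) :+ (y :- w)) refl
               (f a) (g a) (f b) (g b)) ⟩
        ∣ (f a - f b) + (g a - g b) ∣
          ≤⟨ ℚ.∣p+q∣≤∣p∣+∣q∣ (f a - f b) (g a - g b) ⟩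
        ∣ f a - f b ∣ + ∣ g a - g b ∣
          ≤⟨ ℚ.+-mono-≤ (lipschitz F a b 1≤a 1≤b) (lipschitz G a b 1≤a 1≤b) ⟩
        slope F * ∣ a - b ∣ + slope G * ∣ a - b ∣
          ≡⟨ ℚ.*-distribʳ-+ ∣ a - b ∣ (slope F) (slope G) ⟨
        (slope F + slope G) * ∣ a - b ∣ ∎
    }
    where open ℚ.≤-Reasoning

  lip-* : ∀ {f g} → Lipschitz f → Lipschitz g → Lipschitz (λ a → f a * g a)
  lip-* {f} {g} F G = record
    { bound = bound F * bound G ; slope = bound F * slope G + bound G * slope F
    ; bound≥0 = 0≤* (bound≥0 F) (bound≥0 G)
    ; slope≥0 = 0≤+ (0≤* (bound≥0 F) (slope≥0 G)) (0≤* (bound≥0 G) (slope≥0 F))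
    ; bounded   = λ a 1≤a → subst (_≤ bound F * bound G) (sym (ℚ.∣p*q∣≡∣p∣*∣q∣ (f a) (g a)))
        (*-mono-≤ (ℚ.0≤∣p∣ (g a)) (bound≥0 F) (bounded F a 1≤a) (bounded G a 1≤a))
    ; lipschitz = λ a b 1≤a 1≤b → begin
        ∣ f a * g a - f b * g b ∣
          ≡⟨ cong ∣_∣ (solve 4 (λ x y z w → x :* y :- z :* w := x :* (y :- w) :+ w :* (x :- z)) refl
               (f a) (g a) (f b) (g b)) ⟩
        ∣ f a * (g a - g b) + g b * (f a - f b) ∣
          ≤⟨ ℚ.∣p+q∣≤∣p∣+∣q∣ (f a * (g a - g b)) (g b * (f a - f b)) ⟩
        ∣ f a * (g a - g b) ∣ + ∣ g b * (f a - f b) ∣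
          ≡⟨ cong₂ _+_ (ℚ.∣p*q∣≡∣p∣*∣q∣ (f a) (g a - g b)) (ℚ.∣p*q∣≡∣p∣*∣q∣ (g b) (f a - f b)) ⟩
        ∣ f a ∣ * ∣ g a - g b ∣ + ∣ g b ∣ * ∣ f a - f b ∣
          ≤⟨ ℚ.+-mono-≤
               (*-mono-≤ (ℚ.0≤∣p∣ (g a - g b)) (bound≥0 F) (bounded F a 1≤a) (lipschitz G a b 1≤a 1≤b))
               (*-mono-≤ (ℚ.0≤∣p∣ (f a - f b)) (bound≥0 G) (bounded G b 1≤b) (lipschitz F a b 1≤a 1≤b)) ⟩
        bound F * (slope G * ∣ a - b ∣) + bound G * (slope F * ∣ a - b ∣)
          ≡⟨ solve 5 (λ x y z w d → x :* (y :* d) :+ z :* (w :* d) := (x :* y :+ z :* w) :* d) refl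
               (bound F) (slope G) (bound G) (slope F) ∣ a - b ∣ ⟩
        (bound F * slope G + bound G * slope F) * ∣ a - b ∣ ∎
    }
    where open ℚ.≤-Reasoning

  lip-neg : ∀ {f} → Lipschitz f → Lipschitz (λ a → - f a)
  lip-neg {f} F = record
    { bound = bound F ; slope = slope F ; bound≥0 = bound≥0 F ; slope≥0 = slope≥0 F
    ; bounded   = λ a 1≤a → subst (_≤ bound F) (sym (ℚ.∣-p∣≡∣p∣ (f a))) (bounded F a 1≤a)
    ; lipschitz = λ a b 1≤a 1≤b → subst (_≤ slope F * ∣ a - b ∣)
        (trans (∣-∣-flip (f a) (f b))
          (cong ∣_∣ (solve 2 (λ x y → y :- x := :- x :- :- y) refl (f a) (f b))))
        (lipschitz F a b 1≤a 1≤b)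
    }

  ∣inv∣≤1 : ∀ {a} → 1ℚ ≤ a → ∣ inv a ∣ ≤ 1ℚ
  ∣inv∣≤1 {a} 1≤a = subst (_≤ 1ℚ) (sym (ℚ.0≤p⇒∣p∣≡p (inv≥0 a))) (inv≤1 1≤a)

  lip-inv : Lipschitz inv
  lip-inv = record
    { bound = 1ℚ ; slope = 1ℚ ; bound≥0 = ℚ.<⇒≤ 0<1 ; slope≥0 = ℚ.<⇒≤ 0<1
    ; bounded   = λ _ → ∣inv∣≤1
    ; lipschitz = λ a b 1≤a 1≤b → begin
        ∣ inv a - inv b ∣              ≡⟨ cong ∣_∣ (inv-sub 1≤a 1≤b) ⟩
        ∣ inv a * inv b * (b - a) ∣    ≡⟨ ℚ.∣p*q∣≡∣p∣*∣q∣ (inv a * inv b) (b - a) ⟩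
        ∣ inv a * inv b ∣ * ∣ b - a ∣  ≡⟨ cong₂ _*_ (ℚ.∣p*q∣≡∣p∣*∣q∣ (inv a) (inv b)) (∣-∣-flip b a) ⟩
        ∣ inv a ∣ * ∣ inv b ∣ * ∣ a - b ∣
          ≤⟨ ℚ.*-monoʳ-≤-nonNeg ∣ a - b ∣ {{ℚ.∣-∣-nonNeg (a - b)}}
               (*-mono-≤ (ℚ.0≤∣p∣ (inv b)) (ℚ.<⇒≤ 0<1) (∣inv∣≤1 1≤a) (∣inv∣≤1 1≤b)) ⟩
        1ℚ * ∣ a - b ∣ ∎
    }
    where open ℚ.≤-Reasoning

  lip-shift : ∀ {f} → Lipschitz f → Lipschitz (λ a → f (a + 1ℚ))
  lip-shift {f} F = record
    { bound = bound F ; slope = slope F ; bound≥0 = bound≥0 F ; slope≥0 = slope≥0 F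
    ; bounded   = λ a 1≤a → bounded F (a + 1ℚ) (weaken-1≤ 1≤a)
    ; lipschitz = λ a b 1≤a 1≤b →
        subst (λ d → ∣ f (a + 1ℚ) - f (b + 1ℚ) ∣ ≤ slope F * ∣ d ∣)
          (solve 2 (λ a b → a :+ con 1ℚ :- (b :+ con 1ℚ) := a :- b) refl a b)
          (lipschitz F (a + 1ℚ) (b + 1ℚ) (weaken-1≤ 1≤a) (weaken-1≤ 1≤b))
    }

  lip-entry : ∀ b {s u} → Lipschitz s → Lipschitz u → Lipschitz (λ a → entry b (s a) (u a) a)
  lip-entry true  S U = lip-* (lip-+ S U) (lip-shift lip-inv)
  lip-entry false S U = lip-* U lip-inv

  lip-rest   : ∀ {n} (t : Vec Bool n) → Lipschitz (rest t)
  lip-weight : ∀ {n} (t : Vec Bool n) → Lipschitz (weight t)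
  lip-rest []      = lip-const 1ℚ
  lip-rest (b ∷ t) = lip-+ (lip-rest t) (lip-neg (lip-entry b (lip-rest t) (lip-weight t)))
  lip-weight []      = lip-const 0ℚ
  lip-weight (b ∷ t) =
    lip-+ (lip-weight t) (lip-* (lip-const [ b ]) (lip-entry b (lip-rest t) (lip-weight t)))

  lip-eigvec : ∀ {n} (t : Vec Bool n) i → Lipschitz (λ a → eigvec t a i)
  lip-eigvec (b ∷ t) zero    = lip-entry b (lip-rest t) (lip-weight t)
  lip-eigvec (b ∷ t) (suc i) = lip-eigvec t i

  -- Natural numbers in ℚ

  -- Every term of the sequence of `fromℕ k` is this rational by definition.
  ι : ℕ → ℚ
  ι k = ℤ.+ k / 1

  -- The quotient `_/_` is normalised by a gcd, which does not reduce for a variable `k`; arithmetic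
  -- on `ι` is therefore checked in the unnormalised rationals.
  toℚᵘ-ι : ∀ k → toℚᵘ (ι k) ℚᵘ.≃ mkℚᵘ (ℤ.+ k) 0
  toℚᵘ-ι k = ℚ.toℚᵘ-fromℚᵘ (mkℚᵘ (ℤ.+ k) 0)

  ι-+ : ∀ m n → ι (m ℕ.+ n) ≡ ι m + ι n
  ι-+ m n = ℚ.toℚᵘ-injective (begin
    toℚᵘ (ι (m ℕ.+ n))            ≈⟨ toℚᵘ-ι (m ℕ.+ n) ⟩
    mkℚᵘ (ℤ.+ (m ℕ.+ n)) 0          ≈⟨ *≡* (cong (ℤ._* ℤ.+ 1)
      (trans (ℤ.pos-+ m n) (sym (cong₂ ℤ._+_ (ℤ.*-identityʳ (ℤ.+ m)) (ℤ.*-identityʳ (ℤ.+ n)))))) ⟩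
    mkℚᵘ (ℤ.+ m) 0 ℚᵘ.+ mkℚᵘ (ℤ.+ n) 0  ≈⟨ ℚᵘ.+-cong (toℚᵘ-ι m) (toℚᵘ-ι n) ⟨
    toℚᵘ (ι m) ℚᵘ.+ toℚᵘ (ι n)    ≈⟨ ℚ.toℚᵘ-homo-+ (ι m) (ι n) ⟨
    toℚᵘ (ι m + ι n)              ∎)
    where open ℚᵘ.≃-Reasoning

  ι-* : ∀ m n → ι (m ℕ.* n) ≡ ι m * ι n
  ι-* m n = ℚ.toℚᵘ-injective (begin
    toℚᵘ (ι (m ℕ.* n))            ≈⟨ toℚᵘ-ι (m ℕ.* n) ⟩
    mkℚᵘ (ℤ.+ (m ℕ.* n)) 0          ≈⟨ *≡* (cong (ℤ._* ℤ.+ 1) (ℤ.pos-* m n)) ⟩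
    mkℚᵘ (ℤ.+ m) 0 ℚᵘ.* mkℚᵘ (ℤ.+ n) 0  ≈⟨ ℚᵘ.*-cong (toℚᵘ-ι m) (toℚᵘ-ι n) ⟨
    toℚᵘ (ι m) ℚᵘ.* toℚᵘ (ι n)    ≈⟨ ℚ.toℚᵘ-homo-* (ι m) (ι n) ⟨
    toℚᵘ (ι m * ι n)              ∎)
    where open ℚᵘ.≃-Reasoning

  ι≥0 : ∀ k → 0ℚ ≤ ι k
  ι≥0 zero    = ℚ.≤-refl
  ι≥0 (suc k) = subst (0ℚ ≤_) (sym (ι-+ 1 k)) (0≤+ (ℚ.<⇒≤ 0<1) (ι≥0 k))

  archimedean : ∀ p → ∃[ k ] p ≤ ι k
  archimedean p@record{} = k , ℚ.toℚᵘ-cancel-≤ (begin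
    toℚᵘ p         ≤⟨ ℚᵘ.*≤* (ℤ.≤-trans (ℤ.≤-reflexive (ℤ.*-identityʳ (ℚ.↥ p)))
                      (ℤ.≤-trans (≤∣∣ (ℚ.↥ p)) (bigger (ℚ.denominator-1 p)))) ⟩
    mkℚᵘ (ℤ.+ k) 0   ≃⟨ toℚᵘ-ι k ⟨
    toℚᵘ (ι k)     ∎)
    where
    open ℚᵘ.≤-Reasoning
    -- The absolute value of the numerator suffices, as the denominator is at least 1.
    k = ℤ.∣ ℚ.↥ p ∣
    ≤∣∣ : ∀ i → i ℤ.≤ ℤ.+ ℤ.∣ i ∣
    ≤∣∣ (ℤ.+ n)       = ℤ.≤-refl
    ≤∣∣ ℤ.-[1+ n ] = ℤ.-≤+
    bigger : ∀ d → ℤ.+ k ℤ.≤ ℤ.+ k ℤ.* ℤ.+ suc d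
    bigger d = subst (ℤ.+ k ℤ.≤_) (ℤ.pos-* k (suc d)) (ℤ.+≤+ (ℕ.m≤m*n k (suc d)))

  -- Null sequences and bisection

  Null : (ℕ → ℚ) → Set
  Null s = ∀ ε → 0ℚ < ε → ∃[ N ] (∀ n → N ℕ.≤ n → ∣ s n ∣ < ε)

  null-0 : Null (λ _ → 0ℚ)
  null-0 ε 0<ε = 0 , λ _ _ → 0<ε

  null-+ : ∀ {s t} → Null s → Null t → Null (λ n → s n + t n)
  null-+ {s} {t} S T ε 0<ε =
    let M , close₁ = S (½ * ε) (half>0 0<ε)
        N , close₂ = T (½ * ε) (half>0 0<ε)
    in M ℕ.⊔ N , λ n M⊔N≤n → ℚ.≤-<-trans (ℚ.∣p+q∣≤∣p∣+∣q∣ (s n) (t n))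
         (subst (∣ s n ∣ + ∣ t n ∣ <_) (half+half ε)
           (ℚ.+-mono-< (close₁ n (ℕ.m⊔n≤o⇒m≤o M N M⊔N≤n)) (close₂ n (ℕ.m⊔n≤o⇒n≤o M N M⊔N≤n))))

  null-resp : ∀ {s t} → (∀ n → s n ≡ t n) → Null s → Null t
  null-resp s≡t S ε 0<ε =
    let N , close = S ε 0<ε in N , λ n N≤n → subst (λ x → ∣ x ∣ < ε) (s≡t n) (close n N≤n)

  module _ {B ε} (0≤B : 0ℚ ≤ B) (0<ε : 0ℚ < ε) where

    -- Dividing by `B + 1` instead of `B` covers B = 0 and keeps the argument of `inv` at least 1,
    -- where it is the true inverse.
    scaled : ℚ
    scaled = inv (B + 1ℚ) * ε

    scaled>0 : 0ℚ < scaled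
    scaled>0 = 0<* (inv>0 (B + 1ℚ)) 0<ε

    *-scaled : ∀ {x} → 0ℚ ≤ x → x < scaled → B * x < ε
    *-scaled {x} 0≤x x<δ = begin-strict
      B * x                ≤⟨ ≤-by x (solve 2 (λ b x → (b :+ con 1ℚ) :* x :- b :* x := x) refl B x) 0≤x ⟩
      (B + 1ℚ) * x         <⟨ ℚ.*-monoʳ-<-pos (B + 1ℚ) {{positive (ℚ.+-mono-≤-< 0≤B 0<1)}} x<δ ⟩
      (B + 1ℚ) * scaled    ≡⟨ ℚ.*-assoc (B + 1ℚ) (inv (B + 1ℚ)) ε ⟨
      (B + 1ℚ) * inv (B + 1ℚ) * ε  ≡⟨ cong (_* ε) (*-inv (ℚ.+-monoˡ-≤ 1ℚ 0≤B)) ⟩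
      1ℚ * ε               ≡⟨ ℚ.*-identityˡ ε ⟩
      ε                    ∎
      where open ℚ.≤-Reasoning

  null-dominated : ∀ {s t B} → 0ℚ ≤ B → (∀ n → ∣ s n ∣ ≤ B * ∣ t n ∣) → Null t → Null s
  null-dominated {t = t} 0≤B s≤Bt T ε 0<ε =
    let N , close = T (scaled 0≤B 0<ε) (scaled>0 0≤B 0<ε)
    in N , λ n N≤n → ℚ.≤-<-trans (s≤Bt n) (*-scaled 0≤B 0<ε (ℚ.0≤∣p∣ (t n)) (close n N≤n))

  lipschitz-cauchy : ∀ {f s} → Lipschitz f → (∀ n → 1ℚ ≤ s n) → IsCauchy s → IsCauchy (f ∘ s)
  lipschitz-cauchy {f} {s} F 1≤s S ε 0<ε =
    let N , close = S (scaled (slope≥0 F) 0<ε) (scaled>0 (slope≥0 F) 0<ε)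
    in N , λ m n N≤m N≤n → ℚ.≤-<-trans (lipschitz F (s m) (s n) (1≤s m) (1≤s n))
         (*-scaled (slope≥0 F) 0<ε (ℚ.0≤∣p∣ (s m - s n)) (close m n N≤m N≤n))

  ∣∣≤ : ∀ {x d} → - d ≤ x → x ≤ d → ∣ x ∣ ≤ d
  ∣∣≤ {x} {d} -d≤x x≤d with ℚ.∣p∣≡p∨∣p∣≡-p x
  ... | inj₁ eq rewrite eq = x≤d
  ... | inj₂ eq rewrite eq = ≤-by (x - - d) (solve 2 (λ x d → d :- :- x := x :- :- d) refl x d) (gap -d≤x)

  x≤∣x∣ : ∀ x → x ≤ ∣ x ∣
  x≤∣x∣ x with ℚ.≤-total 0ℚ x
  ... | inj₁ 0≤x = ℚ.≤-reflexive (sym (ℚ.0≤p⇒∣p∣≡p 0≤x))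
  ... | inj₂ x≤0 = ℚ.≤-trans x≤0 (ℚ.0≤∣p∣ x)

  close-above : ∀ x y {δ} → ∣ x - y ∣ < δ → x < y + δ
  close-above x y {δ} close = <-by (δ - (x - y))
    (solve 3 (λ x y d → y :+ d :- x := d :- (x :- y)) refl x y δ)
    (<-gap (ℚ.≤-<-trans (x≤∣x∣ (x - y)) close))

  close-below : ∀ x y {δ} → ∣ x - y ∣ < δ → y < x + δ
  close-below x y close = close-above y x (subst (_< _) (∣-∣-flip x y) close)

  ∣-∣≤width : ∀ {l h x y} → l ≤ x → x ≤ h → l ≤ y → y ≤ h → ∣ x - y ∣ ≤ h - l
  ∣-∣≤width {l} {h} {x} {y} l≤x x≤h l≤y y≤h = ∣∣≤
    (≤-by ((x - l) + (h - y))
      (solve 4 (λ l h x y → x :- y :- :- (h :- l) := (x :- l) :+ (h :- y)) refl l h x y)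
      (0≤+ (gap l≤x) (gap y≤h)))
    (≤-by ((h - x) + (y - l))
      (solve 4 (λ l h x y → h :- l :- (x :- y) := (h :- x) :+ (y :- l)) refl l h x y)
      (0≤+ (gap x≤h) (gap l≤y)))

  module Bisection {P : ℚ → Set} (P? : ∀ a → Dec (P a)) where

    -- Only a failure at `lo` and a success at `hi` are recorded, so bisection closes in on some
    -- boundary point of `P`.
    record Bracket : Set where
      field
        lo hi : ℚ
        lo≤hi : lo ≤ hi
        fails : ¬ P lo
        holds : P hi
      width : ℚ
      width = hi - lo

    open Bracket

    _⊑_ : Bracket → Bracket → Set
    A ⊑ B = lo B ≤ lo A × hi A ≤ hi B

    mid : Bracket → ℚ
    mid B = ½ * (lo B + hi B)

    ½width≥0 : ∀ B → 0ℚ ≤ ½ * width B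
    ½width≥0 B = 0≤* (ℚ.<⇒≤ (ℚ.positive⁻¹ ½)) (gap (lo≤hi B))

    hi-mid : ∀ B → hi B - mid B ≡ ½ * width B
    hi-mid B = solve 2 (λ l h → h :- con ½ :* (l :+ h) := con ½ :* (h :- l)) refl (lo B) (hi B)

    mid-lo : ∀ B → mid B - lo B ≡ ½ * width B
    mid-lo B = solve 2 (λ l h → con ½ :* (l :+ h) :- l := con ½ :* (h :- l)) refl (lo B) (hi B)

    halve : ∀ B → ∃[ A ] (A ⊑ B × width A ≡ ½ * width B)
    halve B with P? (mid B)
    ... | yes p = record { lo = lo B ; hi = mid B ; lo≤hi = lo≤mid ; fails = fails B ; holds = p }
                , (ℚ.≤-refl , ≤-by (½ * width B) (hi-mid B) (½width≥0 B)) , mid-lo B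
      where lo≤mid = ≤-by (½ * width B) (mid-lo B) (½width≥0 B)
    ... | no ¬p = record { lo = mid B ; hi = hi B ; lo≤hi = mid≤hi ; fails = ¬p ; holds = holds B }
                , (≤-by (½ * width B) (mid-lo B) (½width≥0 B) , ℚ.≤-refl) , hi-mid B
      where mid≤hi = ≤-by (½ * width B) (hi-mid B) (½width≥0 B)

    module _ (B₀ : Bracket) where

      bracket : ℕ → Bracket
      bracket zero    = B₀
      bracket (suc k) = proj₁ (halve (bracket k))

      nested : ∀ {m n} → m ℕ.≤′ n → bracket n ⊑ bracket m
      nested ℕ.≤′-refl             = ℚ.≤-refl , ℚ.≤-refl
      nested (ℕ.≤′-step {n} m≤′n) =
        let l≤ , ≤h = nested m≤′n ; l≤′ , ≤h′ = proj₁ (proj₂ (halve (bracket n)))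
        in ℚ.≤-trans l≤ l≤′ , ℚ.≤-trans ≤h′ ≤h

      -- Halving the width offsets the growth of the factor, because (2 + k)/2 ≤ 1 + k; linear decay
      -- is all that `width-small` asks for.
      width-decay : ∀ k → width (bracket k) * (1ℚ + ι k) ≤ width B₀
      width-decay zero    = ℚ.≤-reflexive (ℚ.*-identityʳ (width B₀))
      width-decay (suc k) = ℚ.≤-trans
        (≤-by (½ * w * ι k)
          (trans (cong₂ (λ x y → w * (1ℚ + ι k) - x * (1ℚ + y))
                   (proj₂ (proj₂ (halve (bracket k)))) (ι-+ 1 k))
            (solve 2 (λ w n → w :* (con 1ℚ :+ n) :- con ½ :* w :* (con 1ℚ :+ (con 1ℚ :+ n)) :=
              con ½ :* w :* n) refl w (ι k)))
          (0≤* (½width≥0 (bracket k)) (ι≥0 k)))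
        (width-decay k)
        where w = width (bracket k)

      width-small : ∀ ε → 0ℚ < ε → ∃[ N ] width (bracket N) < ε
      width-small ε 0<ε = k , ℚ.*-cancelʳ-<-nonNeg (1ℚ + ι k)
        {{nonNegative (0≤+ (ℚ.<⇒≤ 0<1) (ι≥0 k))}} (ℚ.≤-<-trans (width-decay k) (begin-strict
          w                    ≡⟨ ℚ.*-identityʳ w ⟨
          w * 1ℚ               ≡⟨ cong (w *_) (ℚ.*-inverseˡ ε {{nz}}) ⟨
          w * (ε⁻¹ * ε)        ≡⟨ ℚ.*-assoc w ε⁻¹ ε ⟨
          w * ε⁻¹ * ε          ≤⟨ ℚ.*-monoʳ-≤-nonNeg ε
                                    {{nonNegative (ℚ.<⇒≤ 0<ε)}} (proj₂ (archimedean (w * ε⁻¹))) ⟩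
          ι k * ε              <⟨ <-by ε
                                    (solve 2 (λ n e → e :* (con 1ℚ :+ n) :- n :* e := e) refl (ι k) ε) 0<ε ⟩
          ε * (1ℚ + ι k)       ∎))
        where
        open ℚ.≤-Reasoning
        w = width B₀
        nz = ℚ.pos⇒nonZero ε {{positive 0<ε}}
        ε⁻¹ = (1/ ε) {{nz}}
        -- At least width/ε, so that width/(1 + k) lies below ε.
        k = proj₁ (archimedean (w * ε⁻¹))

      his-cauchy : IsCauchy (hi ∘ bracket)
      his-cauchy ε 0<ε =
        let N , small = width-small ε 0<ε
        in N , λ m n N≤m N≤n →
          let l≤m , m≤h = nested (ℕ.≤⇒≤′ N≤m) ; l≤n , n≤h = nested (ℕ.≤⇒≤′ N≤n)
          in ℚ.≤-<-trans
               (∣-∣≤width (ℚ.≤-trans l≤m (lo≤hi (bracket m))) m≤h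
                          (ℚ.≤-trans l≤n (lo≤hi (bracket n))) n≤h) small

      hi-lo-null : Null (λ k → hi (bracket k) - lo (bracket k))
      hi-lo-null ε 0<ε =
        let N , small = width-small ε 0<ε
        in N , λ n N≤n →
          let l≤ , ≤h = nested (ℕ.≤⇒≤′ N≤n)
          in ℚ.≤-<-trans
               (∣-∣≤width (ℚ.≤-trans l≤ (lo≤hi (bracket n))) ≤h
                          l≤ (ℚ.≤-trans (lo≤hi (bracket n)) ≤h)) small

  -- A root of the recursion by bisection

  module _ {n} (t : Vec Bool n) {q : ℚ} (1≤q : 1ℚ ≤ q) (¬pos : ¬ AllPositive t q) where

    open Bisection (allPositive? t)
    open Bracket

    start : Bracket
    start = record
      { lo = q ; hi = top ; lo≤hi = q≤top ; fails = ¬pos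
      ; holds = proj₁ (allPositive t (ℚ.≤-trans 1≤q q≤top) len<top)
      }
      where
      -- Above `q` and also above the length, where positivity is known.
      top = q + (1ℚ + len t)
      q≤top : q ≤ top
      q≤top = ≤-by (1ℚ + len t) (solve 2 (λ q l → q :+ l :- q := l) refl q (1ℚ + len t))
        (0≤+ (ℚ.<⇒≤ 0<1) (len≥0 t))
      len<top : len t < top
      len<top = <-by (q + 1ℚ) (solve 2 (λ q l → q :+ (con 1ℚ :+ l) :- l := q :+ con 1ℚ) refl q (len t))
        (ℚ.<-≤-trans 0<1 (weaken-1≤ 1≤q))

    los his : ℕ → ℚ
    los k = lo (bracket start k)
    his k = hi (bracket start k)

    q≤los : ∀ k → q ≤ los k
    q≤los k = proj₁ (nested start (ℕ.≤⇒≤′ (ℕ.z≤n {k})))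

    q≤his : ∀ k → q ≤ his k
    q≤his k = ℚ.≤-trans (q≤los k) (lo≤hi (bracket start k))

    -- While AllPositive holds, rest is smallest at the front of the sequence.
    positive-left : ∀ ε → 0ℚ < ε → ∀ {m} (s : Vec Bool m) → ∃[ N ] (∀ k → N ℕ.≤ k →
      AllPositive s (his k) → ε ≤ rest s (his k) → AllPositive s (los k))
    positive-left ε 0<ε []      = 0 , λ _ _ _ _ → tt
    positive-left ε 0<ε (b ∷ s) =
      let M , tail = positive-left ε 0<ε s
          -- Late brackets are so short that `rest` changes by less than ε between their ends; a
          -- value of at least ε at the upper end then stays positive at the lower end.
          N , close = null-dominated (slope≥0 F)
            (λ k → lipschitz F (his k) (los k) (ℚ.≤-trans 1≤q (q≤his k)) (ℚ.≤-trans 1≤q (q≤los k)))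
            (hi-lo-null start) ε 0<ε
      in M ℕ.⊔ N , λ k M⊔N≤k (_ , p) ε≤r →
        let r<l+ε = close-above (rest (b ∷ s) (his k)) (rest (b ∷ s) (los k))
                      (close k (ℕ.m⊔n≤o⇒n≤o M N M⊔N≤k))
        in <-by _ (solve 2 (λ l e → l :- con 0ℚ := l :+ e :- e) refl (rest (b ∷ s) (los k)) ε)
             (<-gap (ℚ.≤-<-trans ε≤r r<l+ε))
         , tail k (ℕ.m⊔n≤o⇒m≤o M N M⊔N≤k) p (ℚ.≤-trans ε≤r (rest-decreasing b s p))
      where F = lip-rest (b ∷ s)

    -- For late k a value of at least ε at the upper end would make everything positive at the lower
    -- end as well, against the bracket. So the value, positive by the bracket, is below ε.
    rest-root : Null (rest t ∘ his)
    rest-root ε 0<ε =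
      let N , left = positive-left ε 0<ε t
      in N , λ k N≤k → small k (left k N≤k)
      where
      small : ∀ k → (AllPositive t (his k) → ε ≤ rest t (his k) → AllPositive t (los k)) →
              ∣ rest t (his k) ∣ < ε
      small k left with ε ℚ.≤? rest t (his k)
      ... | yes ε≤r = ⊥-elim (fails (bracket start k) (left (holds (bracket start k)) ε≤r))
      ... | no  ε≰r = subst (_< ε)
        (sym (ℚ.0≤p⇒∣p∣≡p (ℚ.<⇒≤ (rest>0 t (holds (bracket start k)))))) (ℚ.≰⇒> ε≰r)

    -- With the upper ends themselves as the Cauchy sequence, the bound by `q` holds at every index,
    -- as the Lipschitz domain a ≥ 1 requires.
    limit-root : ∃[ μ ] ((∀ k → q ≤ seq μ k) × Null (rest t ∘ seq μ))
    limit-root = mkℝ his (his-cauchy start) , q≤his , rest-root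

  -- The eigenvector at a root

  null-sum : ∀ {m} (f : Fin m → ℕ → ℚ) → (∀ i → Null (f i)) → Null (λ k → sum (λ i → f i k))
  null-sum {zero}  f F = null-0
  null-sum {suc m} f F = null-+ {f zero} (F zero) (null-sum (f ∘ suc) (F ∘ suc))

  module _ {n} (t : Vec Bool n) (μ : ℝ) (1≤μ : ∀ k → 1ℚ ≤ seq μ k) (null : Null (rest t ∘ seq μ)) where

    eigvecs : Fin n → ℝ
    eigvecs i = mkℝ (λ k → eigvec t (seq μ k) i)
      (lipschitz-cauchy (lip-eigvec t i) 1≤μ (cauchy μ))

    -- By `eigen-eq` the defect is `rest` times 0 or 1, and `rest` tends to 0 along μ.
    residual : ∀ i → Null (λ k → sum (λ j → [ adjacent t i j ] * eigvec t (seq μ k) j)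
                                 - seq μ k * eigvec t (seq μ k) i)
    residual i = null-dominated (ℚ.<⇒≤ 0<1) (λ k → begin
      ∣ S k - seq μ k * v k ∣          ≡⟨ cong (λ x → ∣ x - seq μ k * v k ∣) (eigen-eq t (1≤μ k) i) ⟩
      ∣ seq μ k * v k - [ b ] * rest t (seq μ k) - seq μ k * v k ∣
        ≡⟨ cong ∣_∣ (solve 2 (λ x y → x :- y :- x := :- y) refl (seq μ k * v k) ([ b ] * rest t (seq μ k))) ⟩
      ∣ - ([ b ] * rest t (seq μ k)) ∣ ≡⟨ ℚ.∣-p∣≡∣p∣ ([ b ] * rest t (seq μ k)) ⟩
      ∣ [ b ] * rest t (seq μ k) ∣     ≡⟨ ℚ.∣p*q∣≡∣p∣*∣q∣ [ b ] (rest t (seq μ k)) ⟩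
      ∣ [ b ] ∣ * ∣ rest t (seq μ k) ∣
        ≤⟨ ℚ.*-monoʳ-≤-nonNeg ∣ rest t (seq μ k) ∣
           {{ℚ.∣-∣-nonNeg (rest t (seq μ k))}} ∣[ b ]∣≤1 ⟩
      1ℚ * ∣ rest t (seq μ k) ∣        ∎) null
      where
      open ℚ.≤-Reasoning
      b = lookup t i
      v S : ℕ → ℚ
      v k = eigvec t (seq μ k) i
      S k = sum (λ j → [ adjacent t i j ] * eigvec t (seq μ k) j)
      ∣[_]∣≤1 : ∀ b → ∣ [ b ] ∣ ≤ 1ℚ
      ∣[ true  ]∣≤1 = ℚ.≤-refl
      ∣[ false ]∣≤1 = ℚ.<⇒≤ 0<1

    -- The entries sum to 1 minus `rest`; were they all null, the constant 1 would be null.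
    nonzero : ¬ (∀ i → Null (λ k → eigvec t (seq μ k) i))
    nonzero all0 =
      let N , close = null-resp {s = λ k → sum (eigvec t (seq μ k)) + rest t (seq μ k)}
            (λ k → trans (cong (_+ rest t (seq μ k)) (sum-eigvec t (seq μ k)))
              (solve 1 (λ r → con 1ℚ :- r :+ r := con 1ℚ) refl (rest t (seq μ k))))
            (null-+ {λ k → sum (eigvec t (seq μ k))} (null-sum (λ i k → eigvec t (seq μ k) i) all0) null) 1ℚ 0<1
      in ℚ.<-irrefl refl (close N ℕ.≤-refl)

  -- Threshold graphs

  adjacent-diagonal : ∀ {n} (t : Vec Bool n) i → adjacent t i i ≡ false
  adjacent-diagonal (_ ∷ t) zero    = refl
  adjacent-diagonal (_ ∷ t) (suc i) = adjacent-diagonal t i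

  adjacent-< : ∀ {n} (t : Vec Bool n) i j → i Fin.< j → adjacent t i j ≡ lookup t j
  adjacent-< (_ ∷ t) zero    (suc j) _   = refl
  adjacent-< (_ ∷ t) (suc i) (suc j) i<j = adjacent-< t i j (ℕ.s<s⁻¹ i<j)

  adjacent-sym : ∀ {n} (t : Vec Bool n) i j → adjacent t i j ≡ adjacent t j i
  adjacent-sym (_ ∷ t) zero    zero    = refl
  adjacent-sym (_ ∷ t) zero    (suc j) = refl
  adjacent-sym (_ ∷ t) (suc i) zero    = refl
  adjacent-sym (_ ∷ t) (suc i) (suc j) = adjacent-sym t i j

  re-∑ : ∀ {n} (f : Fin n → ℂ) k → seq (re (∑ f)) k ≡ sum (λ j → seq (re (f j)) k)
  re-∑ {zero}  f k = refl
  re-∑ {suc n} f k = cong (seq (re (f zero)) k +_) (re-∑ (f ∘ suc) k)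

  im-∑ : ∀ {n} (f : Fin n → ℂ) k → seq (im (∑ f)) k ≡ sum (λ j → seq (im (f j)) k)
  im-∑ {zero}  f k = refl
  im-∑ {suc n} f k = cong (seq (im (f zero)) k +_) (im-∑ (f ∘ suc) k)

  sum-0 : ∀ {n} (f : Fin n → ℚ) → (∀ j → f j ≡ 0ℚ) → sum f ≡ 0ℚ
  sum-0 {zero}  f f≡0 = refl
  sum-0 {suc n} f f≡0 = cong₂ _+_ (f≡0 zero) (sum-0 (f ∘ suc) (f≡0 ∘ suc))

  -- Counts and sums over filtered lists

  count : ∀ {n} → (Fin n → Bool) → ℕ
  count {zero}  p = 0
  count {suc n} p = if p zero then suc (count (p ∘ suc)) else count (p ∘ suc)

  count-cong : ∀ {n} {p q : Fin n → Bool} → (∀ i → p i ≡ q i) → count p ≡ count q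
  count-cong {zero}  p≡q = refl
  count-cong {suc n} p≡q rewrite p≡q zero | count-cong (p≡q ∘ suc) = refl

  -- `allFin n` is `tabulate` of the identity; a general `f` lets the induction pass to `f ∘ suc`.
  length-filter : ∀ {A : Set} {P : Pred A 0ℓ} (P? : Decidable P) {n} (f : Fin n → A) →
    length (filter P? (tabulate f)) ≡ count (λ i → does (P? (f i)))
  length-filter P? {zero}  f = refl
  length-filter P? {suc n} f with does (P? (f zero))
  ... | true  = cong suc (length-filter P? (f ∘ suc))
  ... | false = length-filter P? (f ∘ suc)

  sumIf : ∀ {n} → (Fin n → Bool) → (Fin n → ℕ) → ℕ
  sumIf {zero}  p h = 0
  sumIf {suc n} p h = (if p zero then h zero else 0) ℕ.+ sumIf (p ∘ suc) (h ∘ suc)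

  sumIf-cong : ∀ {n} {p q : Fin n → Bool} {g h : Fin n → ℕ} →
    (∀ i → p i ≡ q i) → (∀ i → g i ≡ h i) → sumIf p g ≡ sumIf q h
  sumIf-cong {zero}  p≡q g≡h = refl
  sumIf-cong {suc n} p≡q g≡h
    rewrite p≡q zero | g≡h zero | sumIf-cong (p≡q ∘ suc) (g≡h ∘ suc) = refl

  sum-filter : ∀ {A : Set} {P : Pred A 0ℓ} (P? : Decidable P) (g : A → ℕ) (h : ℕ → ℕ) {n} (f : Fin n → A) →
    sumℕ (map h (map g (filter P? (tabulate f)))) ≡ sumIf (λ i → does (P? (f i))) (λ i → h (g (f i)))
  sum-filter P? g h {zero}  f = refl
  sum-filter P? g h {suc n} f with does (P? (f zero))
  ... | true  = cong (h (g (f zero)) ℕ.+_) (sum-filter P? g h (f ∘ suc))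
  ... | false = sum-filter P? g h (f ∘ suc)

  does-≟true : ∀ b → does (b Bool.≟ true) ≡ b
  does-≟true true  = refl
  does-≟true false = refl

  does-≟false : ∀ b → does (b Bool.≟ false) ≡ not b
  does-≟false true  = refl
  does-≟false false = refl

  -- A structural counterpart of `type1After` that matches the recursion of `squares`.
  after : ∀ {n} → (Fin n → Bool) → Fin n → ℕ
  after p zero    = count (p ∘ suc)
  after p (suc i) = after (p ∘ suc) i

  count-after : ∀ {n} (p : Fin n → Bool) i → count (λ j → does (i Fin.<? j) ∧ p j) ≡ after p i
  count-after p zero    = refl
  count-after p (suc i) = count-after (p ∘ suc) i

  ι-count : ∀ {n} (p : Fin n → Bool) → ι (count p) ≡ ones (Vec.tabulate p)
  ι-count {zero}  p = refl
  ι-count {suc n} p with p zero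
  ... | true  = trans (ι-+ 1 (count (p ∘ suc))) (cong (1ℚ +_) (ι-count (p ∘ suc)))
  ... | false = trans (ι-count (p ∘ suc)) (sym (ℚ.+-identityˡ _))

  ι-sumIf : ∀ {n} (p : Fin n → Bool) →
    ι (sumIf (not ∘ p) (λ i → after p i ℕ.^ 2)) ≡ squares (Vec.tabulate p)
  ι-sumIf {zero}  p = refl
  ι-sumIf {suc n} p with p zero
  ... | true  = ι-sumIf (p ∘ suc)
  ... | false = trans (ι-+ (c ℕ.^ 2) (sumIf (not ∘ p ∘ suc) (λ i → after (p ∘ suc) i ℕ.^ 2)))
    (cong₂ _+_
      -- `c ^ 2` unfolds to `c * (c * 1)`.
      (trans (cong (λ x → ι (c ℕ.* x)) (ℕ.*-identityʳ c))
        (trans (ι-* c c) (cong₂ _*_ (ι-count (p ∘ suc)) (ι-count (p ∘ suc)))))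
      (ι-sumIf (p ∘ suc)))
    where c = count (p ∘ suc)

  count-pos : ∀ {n} (p : Fin n → Bool) i → p i ≡ true → 1 ℕ.≤ count p
  count-pos p zero    pi rewrite pi = ℕ.s≤s ℕ.z≤n
  count-pos p (suc i) pi with p zero
  ... | true  = ℕ.s≤s ℕ.z≤n
  ... | false = count-pos (p ∘ suc) i pi

  count≥2 : ∀ {n} (p : Fin (suc n) → Bool) i → p zero ≡ true → p (suc i) ≡ true → 2 ℕ.≤ count p
  count≥2 p i p0 pi rewrite p0 = ℕ.s≤s (count-pos (p ∘ suc) i pi)

  -- Real eigenvalues and the spectral radius

  null-≃ : ∀ {x y z} → (∀ n → seq x n - seq y n ≡ z n) → Null z → x Defs.≃ y
  null-≃ x-y≡z Z = mk≃ (null-resp (sym ∘ x-y≡z) Z)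

  nonneg-modulus : ∀ x → (∀ k → 0ℚ ≤ seq x k) → IsModulus x (ofReal x)
  nonneg-modulus x 0≤x =
      mk≤ (λ ε 0<ε → 0 , λ k _ → ℚ.+-mono-≤-< (0≤x k) 0<ε)
    , null-≃ (λ k → solve 1 (λ m → m :* (m :* con 1ℚ) :-
        (m :* (m :* con 1ℚ) :+ con 0ℚ :* (con 0ℚ :* con 1ℚ)) := con 0ℚ) refl (seq x k)) null-0

  -- When the imaginary parts vanish, the complex equation comes down to one null sequence of
  -- rationals. The terms `f` and `w` are implicit, so that the goal supplies them.
  ∑-≃ℂ : ∀ {n} {f : Fin n → ℂ} {w : ℂ} (g : Fin n → ℕ → ℚ) (a : ℕ → ℚ) →
    (∀ j k → seq (re (f j)) k ≡ g j k) → (∀ j k → seq (im (f j)) k ≡ 0ℚ) →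
    (∀ k → seq (re w) k ≡ a k) → (∀ k → seq (im w) k ≡ 0ℚ) →
    Null (λ k → sum (λ j → g j k) - a k) → ∑ f Defs.≃ℂ w
  ∑-≃ℂ {n} {f} {w} g a re-f im-f re-w im-w null = mk≃ℂ
    (null-≃ {re (∑ f)} {re w} {λ k → sum (λ j → g j k) - a k} (λ k → cong₂ _-_
      (trans (re-∑ f k) (sum-cong-≗ {n} {λ j → seq (re (f j)) k} {λ j → g j k} (λ j → re-f j k)))
      (re-w k)) null)
    (null-≃ {im (∑ f)} {im w} {λ k → 0ℚ} (λ k → cong₂ _-_
      (trans (im-∑ f k) (sum-0 (λ j → seq (im (f j)) k) (λ j → im-f j k))) (im-w k)) null-0)

  -- The eigenvalue condition is met in place: the complexified matrix is local to
  -- IsSpectralRadius, and comparing it with a copy would unfold Cauchy proofs.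
  real-eigenvalue≤radius : ∀ {n} (M : Fin n → Fin n → ℝ) ρ → IsSpectralRadius M ρ →
    ∀ μ → (∀ k → 0ℚ ≤ seq μ k) → (v : Fin n → ℝ) →
    ¬ (∀ u → Null (seq (v u))) →
    (∀ u → Null (λ k → sum (λ w → seq (M u w) k * seq (v w) k) - seq μ k * seq (v u) k)) →
    μ Defs.≤ ρ
  real-eigenvalue≤radius {n} M ρ (_ , maximal) μ 0≤μ v v≢0 eigen =
    maximal (ofReal μ) μ
      ( (λ u → ofReal (v u))
      , (λ v≃0 → v≢0 λ u → null-resp
          (λ k → solve 1 (λ x → x :- con 0ℚ := x) refl (seq (v u) k))
          (Defs._≃_.close (Defs._≃ℂ_.re≃ (v≃0 u))))
      , λ u → ∑-≃ℂ (λ w k → seq (M u w) k * seq (v w) k) (λ k → seq μ k * seq (v u) k)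
          (λ w k → minus-0*0 (seq (M u w) k * seq (v w) k))
          (λ w k → *0+0* (seq (M u w) k) (seq (v w) k))
          (λ k → minus-0*0 (seq μ k * seq (v u) k))
          (λ k → *0+0* (seq μ k) (seq (v u) k))
          (eigen u))
      (nonneg-modulus μ 0≤μ)
    where
    minus-0*0 : ∀ x → x - 0ℚ * 0ℚ ≡ x
    minus-0*0 = solve 1 (λ x → x :- con 0ℚ :* con 0ℚ := x) refl
    *0+0* : ∀ x y → x * 0ℚ + 0ℚ * y ≡ 0ℚ
    *0+0* = solve 2 (λ x y → x :* con 0ℚ :+ con 0ℚ :* y := con 0ℚ) refl

  -- The adjacency matrix in the threshold order

  module _ {n} (G : SimpleGraph n) (T : ThresholdOrder G) where
    open SimpleGraph G
    open ThresholdOrder T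

    types : Vec Bool n
    types = Vec.tabulate type1

    lookup-types : ∀ i → lookup types i ≡ type1 i
    lookup-types = Vec.lookup∘tabulate type1

    ι-c : ι c ≡ ones types
    ι-c = trans (cong ι (trans (length-filter (λ i → type1 i Bool.≟ true) (λ i → i))
                          (count-cong (does-≟true ∘ type1))))
                (ι-count type1)

    type1After≡after : ∀ i → type1After i ≡ after type1 i
    type1After≡after i = trans
      (length-filter (λ j → (i Fin.<? j) ×-dec (type1 j Bool.≟ true)) (λ j → j))
      (trans (count-cong (λ j → cong (does (i Fin.<? j) ∧_) (does-≟true (type1 j))))
             (count-after type1 i))

    ι-F₁ : ι F₁ ≡ squares types
    ι-F₁ = trans (cong ι (trans
        (sum-filter (λ i → type1 i Bool.≟ false) type1After (ℕ._^ 2) (λ i → i))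
        (sumIf-cong (does-≟false ∘ type1) (cong (ℕ._^ 2) ∘ type1After≡after))))
      (ι-sumIf type1)

    adj-later : ∀ i j → i Fin.< j → does (adj? (vertex j) (vertex i)) ≡ adjacent types j i
    adj-later i j i<j = trans (go (type1 j) refl) (sym (trans (adjacent-sym types j i)
        (trans (adjacent-< types i j i<j) (lookup-types j))))
      where
      go : ∀ b → type1 j ≡ b → does (adj? (vertex j) (vertex i)) ≡ type1 j
      go true  eq = trans (dec-true (adj? _ _) (joined j i i<j eq)) (sym eq)
      go false eq = trans (dec-false (adj? _ _) (isolated j i i<j eq)) (sym eq)

    adj-vertex : ∀ i j → does (adj? (vertex i) (vertex j)) ≡ adjacent types i j
    adj-vertex i j with Fin.<-cmp i j
    ... | tri> _ _ j<i = adj-later j i j<i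
    ... | tri≈ _ refl _ = trans (dec-false (adj? _ _) (irrefl refl)) (sym (adjacent-diagonal types i))
    ... | tri< i<j _ _ = trans swap (trans (adj-later i j i<j) (adjacent-sym types j i))
      where
      swap : does (adj? (vertex i) (vertex j)) ≡ does (adj? (vertex j) (vertex i))
      swap with adj? (vertex j) (vertex i)
      ... | yes e = dec-true (adj? _ _) (symm e)
      ... | no ¬e = dec-false (adj? _ _) (¬e ∘ symm)

    seq-if : ∀ b k → seq (if b then Defs.1ℝ else Defs.0ℝ) k ≡ [ b ]
    seq-if true  k = refl
    seq-if false k = refl

    position : Fin n → Fin n
    position u = order ⟨$⟩ˡ u

    -- Each vertex carries the value of its position, so reindexing the sum along `order` turns a
    -- row of the graph into a row of `adjacent`.
    row : ∀ (v : Fin n → ℚ) u k →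
      sum (λ w → seq (adjacencyMatrix G u w) k * v (position w)) ≡
      sum (λ j → [ adjacent types (position u) j ] * v j)
    row v u k = trans (sum-permute entries order) (sum-cong-≗ {n} {entries ∘ vertex} {entries′} eq)
      where
      entries entries′ : Fin n → ℚ
      entries  w = seq (adjacencyMatrix G u w) k * v (position w)
      entries′ j = [ adjacent types (position u) j ] * v j
      adj-position : ∀ j → does (adj? u (vertex j)) ≡ adjacent types (position u) j
      adj-position j = trans (cong (λ w → does (adj? w (vertex j))) (sym (inverseʳ order)))
        (adj-vertex (position u) j)
      coefficient : ∀ j → seq (adjacencyMatrix G u (vertex j)) k ≡ [ adjacent types (position u) j ]
      coefficient j = trans (seq-if (does (adj? u (vertex j))) k) (cong [_] (adj-position j))
      eq : ∀ j → entries (vertex j) ≡ entries′ j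
      eq j = cong₂ _*_ (coefficient j) (cong v (inverseˡ order {j}))

    eigenvalue≤radius : ∀ {ρ} → IsSpectralRadius (adjacencyMatrix G) ρ →
      ∀ μ → (∀ k → 1ℚ ≤ seq μ k) → Null (rest types ∘ seq μ) → μ Defs.≤ ρ
    eigenvalue≤radius {ρ} isRadius μ 1≤μ null = real-eigenvalue≤radius (adjacencyMatrix G) ρ isRadius
      μ (λ k → ℚ.≤-trans (ℚ.<⇒≤ 0<1) (1≤μ k)) ev ev≢0 ev-eigen
      where
      vs : ℕ → Fin n → ℚ
      vs k = eigvec types (seq μ k)
      ev : Fin n → ℝ
      ev u = eigvecs types μ 1≤μ null (position u)
      ev≢0 : ¬ (∀ u → Null (seq (ev u)))
      ev≢0 all0 = nonzero types μ 1≤μ null λ i →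
        null-resp {seq (ev (vertex i))} {λ k → vs k i}
          (λ k → cong (vs k) (inverseˡ order {i})) (all0 (vertex i))
      ev-eigen : ∀ u → Null (λ k → sum (λ w → seq (adjacencyMatrix G u w) k * seq (ev w) k)
                                   - seq μ k * seq (ev u) k)
      ev-eigen u = null-resp {λ k → rowSum k - seq μ k * vs k (position u)}
        {λ k → matrixSum k - seq μ k * vs k (position u)}
        (λ k → cong (_- seq μ k * vs k (position u)) {rowSum k} {matrixSum k} (sym (row (vs k) u k)))
        (residual types μ 1≤μ null (position u))
        where
        rowSum matrixSum : ℕ → ℚ
        rowSum k = sum (λ j → [ adjacent types (position u) j ] * vs k j)
        matrixSum k = sum (λ w → seq (adjacencyMatrix G u w) k * vs k (position w))

    -- Failure of positivity at `q` yields an eigenvalue at least `q` by bisection, and no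
    -- eigenvalue exceeds ρ in modulus.
    radius-bound : ∀ {ρ} → IsSpectralRadius (adjacencyMatrix G) ρ → ∀ {q} → 1ℚ ≤ q →
      ¬ AllPositive types q → ∀ δ → 0ℚ < δ → ∃[ N ] (∀ k → N ℕ.≤ k → q < seq ρ k + δ)
    radius-bound {ρ} isRadius {q} 1≤q ¬pos δ 0<δ = compare (limit-root types 1≤q ¬pos)
      where
      compare : ∃[ μ ] ((∀ k → q ≤ seq μ k) × Null (rest types ∘ seq μ)) →
        ∃[ N ] (∀ k → N ℕ.≤ k → q < seq ρ k + δ)
      compare (μ , q≤μ , null) = proj₁ μ≤ρ , λ k N≤k → ℚ.≤-<-trans (q≤μ k) (proj₂ μ≤ρ k N≤k)
        where
        μ≤ρ = Defs._≤_.below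
          (eigenvalue≤radius {ρ} isRadius μ (λ k → ℚ.≤-trans 1≤q (q≤μ k)) null) δ 0<δ

  -- The cubic

  -- The polynomial x³ - (d + 1)x² + dx - f, factored up to its constant term.
  cubic : ℚ → ℚ → ℚ → ℚ
  cubic d f x = x * (x - 1ℚ) * (x - d) - f

  -- Expanded around `x` in powers of `y - x`, the difference has coefficients formed from the
  -- nonnegative factors x, x - 1 and x - d.
  cubic-mono : ∀ d f {x y} → 1ℚ ≤ x → d ≤ x → x ≤ y → cubic d f x ≤ cubic d f y
  cubic-mono d f {x} {y} 1≤x d≤x x≤y = ≤-by
    (h * (x * g + x * e + g * e) + h * h * (x + g + e) + h * h * h)
    (solve 4 (λ x y d f →
      let g = x :- con 1ℚ ; e = x :- d ; h = y :- x in
      (y :* (y :- con 1ℚ) :* (y :- d) :- f) :- (x :* g :* e :- f) :=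
      h :* (x :* g :+ x :* e :+ g :* e) :+ h :* h :* (x :+ g :+ e) :+ h :* h :* h) refl x y d f)
    (0≤+ (0≤+ (0≤* 0≤h (0≤+ (0≤+ (0≤* 0≤x 0≤g) (0≤* 0≤x 0≤e)) (0≤* 0≤g 0≤e)))
              (0≤* (0≤* 0≤h 0≤h) (0≤+ (0≤+ 0≤x 0≤g) 0≤e)))
         (0≤* (0≤* 0≤h 0≤h) 0≤h))
    where
    g = x - 1ℚ ; e = x - d ; h = y - x
    0≤x = ℚ.≤-trans (ℚ.<⇒≤ 0<1) 1≤x
    0≤g = gap 1≤x
    0≤e = gap d≤x
    0≤h = gap x≤y

  -- Replacing the factor q + 1 by the smaller d only lowers the product; the loss is (q + 1 - d)²q.
  cubic≤0⇒small : ∀ {d f q} → 0ℚ ≤ q → d ≤ q + 1ℚ → cubic d f (q + 1ℚ) ≤ 0ℚ →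
    d * q * (q + 1ℚ - d) ≤ f
  cubic≤0⇒small {d} {f} {q} 0≤q d≤q+1 p≤0 = ≤-by
    (0ℚ - cubic d f (q + 1ℚ) + (q + 1ℚ - d) * q * (q + 1ℚ - d))
    (solve 3 (λ d f q → let x = q :+ con 1ℚ in
      f :- d :* q :* (x :- d) :=
      con 0ℚ :- (x :* (x :- con 1ℚ) :* (x :- d) :- f) :+ (x :- d) :* q :* (x :- d)) refl d f q)
    (0≤+ (gap p≤0) (0≤* (0≤* (gap d≤q+1) 0≤q) (gap d≤q+1)))

  -- The number of type 1 vertices

  module _ {n} (G : SimpleGraph n) (T : ThresholdOrder G) where
    open SimpleGraph G
    open ThresholdOrder T

    -- A path from the last vertex to another one begins with an edge to an earlier vertex, which
    -- type 0 forbids.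
    last-type1 : Connected G → ∀ l z → (∀ j → ¬ (j ≡ l) → j Fin.< l) → ¬ (z ≡ l) → type1 l ≡ true
    last-type1 connected l z l-last z≢l with type1 l in eq
    ... | true  = refl
    ... | false = ⊥-elim (leave (connected (vertex l) (vertex z)) refl)
      where
      leave : ∀ {w} → Star Adj (vertex l) w → ¬ (w ≡ vertex z)
      leave done            vl≡vz = z≢l (trans (sym (inverseˡ order))
                                (trans (cong (order ⟨$⟩ˡ_) (sym vl≡vz)) (inverseˡ order)))
      leave (_◅_ {j = w} e _) _ with Fin._≟_ (order ⟨$⟩ˡ w) l
      ... | yes j≡l = irrefl (trans (cong vertex (sym j≡l)) (inverseʳ order)) e
      ... | no  j≢l = isolated l (order ⟨$⟩ˡ w) (l-last _ j≢l) eq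
                        (subst (Adj (vertex l)) (sym (inverseʳ order)) e)

  -- The first vertex is of type 1 by convention, the last by connectedness. This will place c - 1,
  -- hence `q`, at 1 or above, where `inv` is the true inverse.
  c≥2 : ∀ {n} → 4 ℕ.≤ n → (G : SimpleGraph n) (T : ThresholdOrder G) → Connected G →
    2 ℕ.≤ count (ThresholdOrder.type1 T)
  c≥2 {suc zero} (ℕ.s≤s ())
  c≥2 {suc (suc m)} _ G T connected = count≥2 type1 (Fin.fromℕ m) (first zero refl)
    (last-type1 G T connected l zero
      (λ j j≢l → Fin.≤∧≢⇒< (Fin.≤fromℕ j) j≢l) λ ())
    where
    open ThresholdOrder T
    l = suc (Fin.fromℕ m)

  -- The comparison of ξ with 1 + ρ

  module _ {n} (4≤n : 4 ℕ.≤ n) (G : SimpleGraph n) (T : ThresholdOrder G) (connected : Connected G)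
           (ρ ξ : ℝ) (isRadius : IsSpectralRadius (adjacencyMatrix G) ρ)
           (isRoot : Null (λ k → cubic (ones (types G T)) (squares (types G T)) (seq ξ k))) where
    open ThresholdOrder T

    d f : ℚ
    d = ones (types G T)
    f = squares (types G T)

    2≤d : 1ℚ + 1ℚ ≤ d
    2≤d = subst (1ℚ + 1ℚ ≤_) (trans (sym (ι-+ 2 (count type1 ℕ.∸ 2)))
        (trans (cong ι (ℕ.m+[n∸m]≡n (c≥2 4≤n G T connected))) (ι-count type1)))
      (subst (_≤ ι 2 + ι (count type1 ℕ.∸ 2)) (ℚ.+-identityʳ (ι 2))
        (ℚ.+-monoʳ-≤ (ι 2) (ι≥0 (count type1 ℕ.∸ 2))))

    1≤d-1 : 1ℚ ≤ d - 1ℚ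
    1≤d-1 = ≤-by (d - (1ℚ + 1ℚ))
      (solve 1 (λ d → d :- con 1ℚ :- con 1ℚ := d :- (con 1ℚ :+ con 1ℚ)) refl d) (gap 2≤d)

    d≤+1 : ∀ q → d - 1ℚ ≤ q → d ≤ q + 1ℚ
    d≤+1 q d-1≤q = ≤-by (q - (d - 1ℚ))
      (solve 2 (λ q d → q :+ con 1ℚ :- d := q :- (d :- con 1ℚ)) refl q d) (gap d-1≤q)

    -- The slack ε is spent in four parts δ: one between two late terms of ξ, two in the choice of
    -- `q₀`, one in the bound by ρ.
    split-slack : ∀ ε x r y → let δ = ½ * (½ * ε) in
      y < x + δ → x - 1ℚ - (δ + δ) < r + δ → y < 1ℚ + r + ε
    split-slack ε x r y y<x+δ q₀<r+δ = let δ = ½ * (½ * ε) in <-by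
      ((x + δ - y) + (r + δ - (x - 1ℚ - (δ + δ))))
      (solve 4 (λ e x r y → let δ = con ½ :* (con ½ :* e) in
        con 1ℚ :+ r :+ e :- y := (x :+ δ :- y) :+ (r :+ δ :- (x :- con 1ℚ :- (δ :+ δ)))) refl ε x r y)
      (ℚ.+-mono-< (<-gap y<x+δ) (<-gap q₀<r+δ))

    -- At q + 1 = d the cubic is -f. Otherwise q + 1 lies below every late term of ξ, so by
    -- monotonicity a positive value there would keep the cubic away from 0 along ξ.
    cubic≤0 : ∀ q δ → 0ℚ < δ → ∀ N →
      (∀ m k → N ℕ.≤ m → N ℕ.≤ k → ∣ seq ξ m - seq ξ k ∣ < δ) →
      d ≤ q + 1ℚ → 1ℚ ≤ q + 1ℚ → q ≡ seq ξ N - 1ℚ - (δ + δ) ⊎ q ≡ d - 1ℚ →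
      cubic d f (q + 1ℚ) ≤ 0ℚ
    cubic≤0 q δ 0<δ N ξ-close d≤q+1 1≤q+1 (inj₂ refl) = ≤-by f
      (solve 2 (λ d f → let x = d :- con 1ℚ :+ con 1ℚ in
        con 0ℚ :- (x :* (x :- con 1ℚ) :* (x :- d) :- f) := f) refl d f)
      (squares≥0 (types G T))
    cubic≤0 q δ 0<δ N ξ-close d≤q+1 1≤q+1 (inj₁ refl) = ℚ.≮⇒≥ λ 0<p →
      -- The tolerance is the supposed positive value itself.
      let M , p-close = isRoot (cubic d f (q + 1ℚ)) 0<p
          k : ℕ
          k = N ℕ.⊔ M
          q+1≤ξ : q + 1ℚ ≤ seq ξ k
          q+1≤ξ = ≤-by (seq ξ k + δ - seq ξ N + δ)
            (solve 3 (λ x y δ → y :- (x :- con 1ℚ :- (δ :+ δ) :+ con 1ℚ) := y :+ δ :- x :+ δ) refl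
              (seq ξ N) (seq ξ k) δ)
            (0≤+ (gap (ℚ.<⇒≤ (close-below (seq ξ k) (seq ξ N)
                   (ξ-close k N (ℕ.m≤m⊔n N M) ℕ.≤-refl)))) (ℚ.<⇒≤ 0<δ))
      in ℚ.<-irrefl refl (ℚ.≤-<-trans (cubic-mono d f 1≤q+1 d≤q+1 q+1≤ξ)
           (ℚ.≤-<-trans (x≤∣x∣ (cubic d f (seq ξ k))) (p-close k (ℕ.m≤n⊔m N M))))

    module _ (ε : ℚ) (0<ε : 0ℚ < ε) where

      δ : ℚ
      δ = ½ * (½ * ε)

      0<δ : 0ℚ < δ
      0<δ = half>0 (half>0 0<ε)

      N : ℕ
      N = proj₁ (cauchy ξ δ 0<δ)

      ξ-close : ∀ m k → N ℕ.≤ m → N ℕ.≤ k → ∣ seq ξ m - seq ξ k ∣ < δ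
      ξ-close = proj₂ (cauchy ξ δ 0<δ)

      -- `q₀ + 1` lies 2δ below the approximation of ξ. The maximum enforces q + 1 ≥ d without
      -- deciding whether the real ξ reaches d.
      q₀ q : ℚ
      q₀ = seq ξ N - 1ℚ - (δ + δ)
      q  = q₀ ⊔ (d - 1ℚ)

      d-1≤q : d - 1ℚ ≤ q
      d-1≤q = ℚ.p≤q⊔p q₀ (d - 1ℚ)

      1≤q : 1ℚ ≤ q
      1≤q = ℚ.≤-trans 1≤d-1 d-1≤q

      q-small : d * q * (q + 1ℚ - d) ≤ f
      q-small = cubic≤0⇒small (ℚ.≤-trans (ℚ.<⇒≤ 0<1) 1≤q) (d≤+1 q d-1≤q)
        (cubic≤0 q δ 0<δ N ξ-close (d≤+1 q d-1≤q) (weaken-1≤ 1≤q) (ℚ.⊔-sel q₀ (d - 1ℚ)))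

      0<d : 0ℚ < d
      0<d = ℚ.<-≤-trans (ℚ.positive⁻¹ (1ℚ + 1ℚ)) 2≤d

      ρ-close : ∃[ M ] (∀ k → M ℕ.≤ k → q < seq ρ k + δ)
      ρ-close = radius-bound G T {ρ} isRadius {q} 1≤q (¬allPositive (types G T) 1≤q 0<d q-small) δ 0<δ

      ξ-eventually : ∃[ K ] (∀ k → K ℕ.≤ k → seq ξ k < 1ℚ + seq ρ k + ε)
      ξ-eventually = N ℕ.⊔ proj₁ ρ-close , λ k K≤k →
        split-slack ε (seq ξ N) (seq ρ k) (seq ξ k)
          (close-above (seq ξ k) (seq ξ N) (ξ-close k N (ℕ.m⊔n≤o⇒m≤o N (proj₁ ρ-close) K≤k) ℕ.≤-refl))
          (ℚ.≤-<-trans (ℚ.p≤p⊔q q₀ (d - 1ℚ)) (proj₂ ρ-close k (ℕ.m⊔n≤o⇒n≤o N (proj₁ ρ-close) K≤k)))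

    ξ≤1+ρ : ξ Defs.≤ Defs.1ℝ Defs.+ ρ
    ξ≤1+ρ = mk≤ ξ-eventually

-- The polynomial over the reals

open import Defs
open import Data.Nat.Combinatorics using (_C_)
open ThresholdOrder using (c)
open ThresholdOrder using (F₁)

-- At each index the real polynomial unfolds to a rational one in `seq ξ k`; what remains is that
-- `ι` respects d + 1, and the factorisation.
seq-cubic : ∀ ξ d f k →
  seq (ξ ^ 3 - fromℕ (d ℕ.+ 1) * ξ ^ 2 + fromℕ d * ξ - fromℕ f) k ≡ cubic (ι d) (ι f) (seq ξ k)
seq-cubic ξ d f k = trans
  (cong (λ a → x ℚ.* (x ℚ.* (x ℚ.* 1ℚ)) ℚ.- a ℚ.* (x ℚ.* (x ℚ.* 1ℚ)) ℚ.+ ι d ℚ.* x ℚ.- ι f)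
    (ι-+ d 1))
  (solve 3 (λ x d f → x :* (x :* (x :* con 1ℚ)) :- (d :+ con 1ℚ) :* (x :* (x :* con 1ℚ))
      :+ d :* x :- f := x :* (x :- con 1ℚ) :* (x :- d) :- f) refl x (ι d) (ι f))
  where x = seq ξ k

≃0⇒null : ∀ {x} → x ≃ 0ℝ → Null (seq x)
≃0⇒null {x} (mk≃ close) = null-resp {λ k → seq x k ℚ.- 0ℚ} {seq x}
  (λ k → ℚ.+-identityʳ (seq x k)) close

theorem4p1 : ∀ (n : ℕ) (G : SimpleGraph n) (T : ThresholdOrder G) →
    4 ℕ.≤ n →
    Connected G →
    n ℕ.∸ 1 ℕ.< size G →
    size G ℕ.< n C 2 →
    ∀ (ρ ξ : ℝ) →
    IsSpectralRadius (adjacencyMatrix G) ρ →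
    IsGreatestRoot
    (λ x → x ^ 3 - fromℕ (c T ℕ.+ 1) * x ^ 2 + fromℕ (c T) * x - fromℕ (F₁ T)) ξ →
    ξ ≤ 1ℝ + ρ
theorem4p1 n G T 4≤n connected _ _ ρ ξ isRadius (root , _) =
  ξ≤1+ρ 4≤n G T connected ρ ξ isRadius (null-resp
    {seq (ξ ^ 3 - fromℕ (c T ℕ.+ 1) * ξ ^ 2 + fromℕ (c T) * ξ - fromℕ (F₁ T))}
    {λ k → cubic (ones (types G T)) (squares (types G T)) (seq ξ k)}
    (λ k → trans (seq-cubic ξ (c T) (F₁ T) k)
      (cong₂ (λ d f → cubic d f (seq ξ k)) (ι-c G T) (ι-F₁ G T)))
    (≃0⇒null root))
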